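{- For any integers $a\geq 3$ and $b\geq 1$, the tadpole graph $T^{\langle a,b\rangle}$ is $e$-positive.
   Context: For a finite simple graph $G$ with vertex set $\{v_1,\dots,v_d\}$, the chromatic symmetric function is $X_G=\sum_{\kappa} x_{\kappa(v_1)}x_{\kappa(v_2)}\cdots x_{\kappa(v_d)}$, where the sum ranges over all proper colorings $\kappa:V(G)\to\{1,2,3,\dots\}$ (adjacent vertices receive different colors), and $x_1,x_2,\dots$ are commuting indeterminates. $G$ is called $e$-positive if all coefficients in the expansion of $X_G$ in the basis of elementary symmetric functions $e_\lambda=e_{\lambda_1}e_{\lambda_2}\cdots$ are non-negative. For $a\ge 3$, $b\ge 1$, the $(a,b)$-tadpole graph $T^{\langle a,b\rangle}$ is the graph on vertices $v_1,\dots,v_{a+b}$ obtained by taking the cycle $v_1v_2\cdots v_a v_1$ and the path $v_{a+1}v_{a+2}\cdots v_{a+b}$ and adding the edge $v_av_{a+1}$. -}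

module Defs where

open import Data.Bool using (Bool; true; false; if_then_else_; _∧_; _∨_; not; T)
open import Data.Nat using (ℕ; zero; suc; _+_; _*_; _∸_; _≤_; _≥_; s≤s; z≤n) renaming (_≡ᵇ_ to _==_)
open import Data.Fin using (Fin; toℕ)
open import Data.List using (List; []; _∷_; [_]; map; concatMap; all; allFin)
open import Data.Nat.ListAction using (sum)
open import Data.Bool.Properties using (∨-comm; ∨-assoc; ∨-identityʳ)
open import Relation.Binary.PropositionalEquality using (refl; cong; cong₂; trans)
open import Data.List.Relation.Unary.All using (All)
open import Data.Vec using (Vec; []; _∷_; lookup)
open import Data.Product using (Σ; _×_; _,_; proj₁; proj₂; ∃)
open import Relation.Binary.PropositionalEquality using (_≡_)

-- Finite simple graphs on the vertex set Fin d (vertex i = v_{i+1}).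

record SimpleGraph (d : ℕ) : Set where
  field
    adj    : Fin d → Fin d → Bool
    sym    : ∀ i j → adj i j ≡ adj j i
    irrefl : ∀ i → adj i i ≡ false

allVecs : ∀ {A : Set} → List A → (d : ℕ) → List (Vec A d)
allVecs xs zero    = [ [] ]
allVecs xs (suc d) = concatMap (λ x → map (x ∷_) (allVecs xs d)) xs

countB : ∀ {A : Set} → (A → Bool) → List A → ℕ
countB p xs = sum (map (λ x → if p x then 1 else 0) xs)

_=ᶠ_ : ∀ {n} → Fin n → Fin n → Bool
i =ᶠ j = toℕ i == toℕ j

-- Chromatic symmetric function X_G, restricted to the variables x_1..x_n.
-- A colouring with colours in {1..n} is a vector κ : Vec (Fin n) d;
-- the monomial x^α (α : Fin n → ℕ exponent vector) has as coefficient
-- the number of proper colourings κ with |κ⁻¹(j)| = α j for every colour j.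

isProper : ∀ {d n} → SimpleGraph d → Vec (Fin n) d → Bool
isProper {d} G κ =
  all (λ i → all (λ j → not (SimpleGraph.adj G i j) ∨ not (lookup κ i =ᶠ lookup κ j))
                 (allFin d))
      (allFin d)

hasContent : ∀ {d n} → Vec (Fin n) d → (Fin n → ℕ) → Bool
hasContent {d} {n} κ α =
  all (λ j → countB (λ i → lookup κ i =ᶠ j) (allFin d) == α j) (allFin n)

coeffX : ∀ {d} → SimpleGraph d → (n : ℕ) → (Fin n → ℕ) → ℕ
coeffX {d} G n α =
  countB (λ κ → isProper G κ ∧ hasContent κ α) (allVecs (allFin n) d)

-- Elementary symmetric functions e_λ = e_{λ₁} e_{λ₂} ⋯ in x_1..x_n.
-- e_k(x_1..x_n) = Σ_{S ⊆ [n], |S| = k} Π_{j∈S} x_j, so the coefficient of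
-- x^α in e_{λ₁}⋯e_{λ_ℓ} is the number of tuples (S_1,…,S_ℓ) of subsets
-- with |S_i| = λ_i such that each j lies in exactly α j of the S_i.

Subset : ℕ → Set
Subset n = Vec Bool n

size : ∀ {n} → Subset n → ℕ
size []          = 0
size (true ∷ s)  = suc (size s)
size (false ∷ s) = size s

subsetsOfSize : (n k : ℕ) → List (Subset n)
subsetsOfSize n k = Data.List.filterᵇ (λ s → size s == k) (allVecs (true ∷ false ∷ []) n)
  where import Data.List

tuplesOfSubsets : (n : ℕ) → List ℕ → List (List (Subset n))
tuplesOfSubsets n []      = [ [] ]
tuplesOfSubsets n (k ∷ λs) =
  concatMap (λ S → map (S ∷_) (tuplesOfSubsets n λs)) (subsetsOfSize n k)

multiplicity : ∀ {n} → List (Subset n) → Fin n → ℕ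
multiplicity Ss j = countB (λ S → lookup S j) Ss

coeffE : List ℕ → (n : ℕ) → (Fin n → ℕ) → ℕ
coeffE λs n α =
  countB (λ Ss → all (λ j → multiplicity Ss j == α j) (allFin n))
         (tuplesOfSubsets n λs)

data Decreasing : List ℕ → Set where
  []  : Decreasing []
  [-] : ∀ {x} → Decreasing (x ∷ [])
  _∷_ : ∀ {x y ys} → x ≥ y → Decreasing (y ∷ ys) → Decreasing (x ∷ y ∷ ys)

IsPartition : ℕ → List ℕ → Set
IsPartition d λs = All (λ p → p ≥ 1) λs × Decreasing λs × sum λs ≡ d

-- e-positivity: X_G = Σ c_λ e_λ with c_λ ≥ 0 (coefficients in ℕ), as an
-- identity of formal power series in x_1,x_2,…, i.e. coefficientwise for
-- every monomial, each of which involves only finitely many variables.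

EPositive : ∀ {d} → SimpleGraph d → Set
EPositive {d} G =
  Σ (List (List ℕ × ℕ)) λ L →
    All (λ p → IsPartition d (proj₁ p)) L ×
    (∀ (n : ℕ) (α : Fin n → ℕ) →
       coeffX G n α ≡ sum (map (λ p → proj₂ p * coeffE (proj₁ p) n α) L))

-- The (a,b)-tadpole graph on Fin (a+b): vertex i is v_{i+1}.
-- Edges: {i, i+1} for 0 ≤ i < a+b-1 (cycle path v_1…v_a, the edge v_a v_{a+1},
-- and the path v_{a+1}…v_{a+b}) together with the closing edge {0, a-1}
-- (i.e. v_1 v_a).

tadpoleAdjℕ : ℕ → ℕ → ℕ → Bool
tadpoleAdjℕ a i j =
  (j == suc i) ∨ (i == suc j) ∨
  ((i == 0) ∧ (j == a ∸ 1)) ∨ ((j == 0) ∧ (i == a ∸ 1))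

tadpoleAdj : (a b : ℕ) → Fin (a + b) → Fin (a + b) → Bool
tadpoleAdj a b i j = tadpoleAdjℕ a (toℕ i) (toℕ j)

private
  n==sucn : ∀ n → (n == suc n) ≡ false
  n==sucn zero    = refl
  n==sucn (suc n) = n==sucn n

  swap4 : ∀ p q r s → (p ∨ q ∨ r ∨ s) ≡ (q ∨ p ∨ s ∨ r)
  swap4 true  true  r s = refl
  swap4 true  false r s = refl
  swap4 false true  r s = refl
  swap4 false false r s = ∨-comm r s

tadpoleAdj-sym : ∀ a b i j → tadpoleAdj a b i j ≡ tadpoleAdj a b j i
tadpoleAdj-sym a b i j = swap4 (toℕ j == suc (toℕ i)) (toℕ i == suc (toℕ j))
  ((toℕ i == 0) ∧ (toℕ j == a ∸ 1)) ((toℕ j == 0) ∧ (toℕ i == a ∸ 1))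

tadpoleAdj-irrefl : ∀ a b → 3 ≤ a → ∀ i → tadpoleAdj a b i i ≡ false
tadpoleAdj-irrefl (suc (suc (suc k))) b (s≤s (s≤s (s≤s z≤n))) i
  rewrite n==sucn (toℕ i) = lem (toℕ i)
  where
    lem : ∀ m → ((m == 0) ∧ (m == suc (suc k))) ∨ ((m == 0) ∧ (m == suc (suc k))) ≡ false
    lem zero    = refl
    lem (suc m) = refl

tadpole : (a b : ℕ) → 3 ≤ a → SimpleGraph (a + b)
tadpole a b h = record
  { adj    = tadpoleAdj a b
  ; sym    = tadpoleAdj-sym a b
  ; irrefl = tadpoleAdj-irrefl a b h
  }

{-# OPTIONS --safe #-}

-- In terms of compositions I = (i₁, i₂, …) of n, and with w_I = i₁ (i₂ - 1) (i₃ - 1) ⋯,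
--   X(P_n) = Σ_I w_I e_I   and   X(C_n) = Σ_I (i₁ - 1) w_I e_I.
-- Both follow by a transfer argument: with y_c = z x_c and E = Π_c (1 + y_c), the generating
-- functions of the words with distinct neighbours and prescribed first and last letters satisfy
-- linear equations with the factor 1 + y_c, and so do the parts of E that contain y_c (and y_d).
-- Comparing colourings gives  X(T(a,b)) + X(P_{a+b}) = X(T(a+1,b-1)) + X(C_a) X(P_b).
-- Let σ_I(s) be the least partial sum of I that is at least s.  Since σ_I(b+1) - σ_I(b) is 0
-- unless b is a partial sum of I, and then it is the next part, the recurrence is solved by
--   X(T(a,b)) = Σ_I w_I (σ_I(b+1) - (b+1)) e_I,
-- whose coefficients are non-negative.
module Submission where

open import Defs
open import Algebra.Bundles using (CommutativeSemiring)
import Algebra.Definitions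
import Algebra.Properties.Semiring.Mult
import Algebra.Properties.Semiring.Sum
import Algebra.Solver.Ring.NaturalCoefficients.Default
open import Algebra.Structures.Biased using (isCommutativeSemiringˡ)
open import Data.Bool using (Bool; true; false; if_then_else_; not; _∧_; _∨_; T)
open import Data.Bool.ListAction using (all; and)
open import Data.Bool.Properties using (T-∧; T-∨; ∧-assoc; ∧-zeroʳ; ∧-identityʳ)
open import Data.Empty using (⊥-elim)
open import Data.Fin using (Fin; zero; suc; toℕ; fromℕ; _↑ˡ_)
open import Data.Fin.Properties using (toℕ-↑ˡ; toℕ-fromℕ)
open import Data.List using (List; []; _∷_; [_]; _++_; map; concatMap; filterᵇ; allFin)
open import Data.List.Properties using (++-assoc; ++-identityʳ; map-cong; map-∘; map-++; map-tabulate)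
open import Data.List.Relation.Binary.Permutation.Propositional as ↭ using (_↭_; ↭-sym)
open import Data.List.Relation.Binary.Permutation.Propositional.Properties using (All-resp-↭)
open import Data.List.Relation.Unary.All as All using (All; []; _∷_)
open import Data.List.Relation.Unary.All.Properties using (map⁺; ++⁺; all⁺; all⁻; tabulate⁺; tabulate⁻)
open import Data.List.Relation.Unary.Linked using (Linked; []; [-]; _∷_)
import Data.List.Sort
open import Data.Nat using (ℕ; zero; suc; _≤_; _≥_; z≤n; s≤s) renaming (_+_ to _+ℕ_; _*_ to _*ℕ_; _≡ᵇ_ to _==_)
open import Data.Nat.ListAction using () renaming (sum to sumℕ)
open import Data.Nat.ListAction.Properties using (sum-++; sum-↭)
import Data.Nat.Properties as ℕ
open import Data.Product using (_,_; _×_; proj₁; proj₂)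
open import Data.Sum using (inj₁; inj₂)
open import Data.Vec using (Vec; []; _∷_; lookup; replicate; tabulate; zipWith)
open import Data.Vec.Properties using (zipWith-assoc; zipWith-comm; zipWith-identityˡ; lookup-zipWith; lookup-replicate; lookup∘tabulate; tabulate∘lookup; tabulate-cong)
open import Function using (_∘_; id)
open import Function.Bundles using (Equivalence)
open import Level using (0ℓ)
open import Relation.Binary using (IsEquivalence)
open import Relation.Binary.Construct.Flip.EqAndOrd using (decTotalOrder)
open import Relation.Binary.PropositionalEquality as ≡ using (_≡_; module ≡-Reasoning)
import Relation.Binary.Reasoning.Setoid

-- Over a ring, the transfer equations would be solved by division: a word starting with c
-- contributes y_c / (1 + y_c) times what may follow. These fractions add up to θE / E, where θ is
-- the Euler operator, so the denominator is E - θE, in which the coefficient of z^k is (1 - k) e_k.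
-- This is where the weights μ - 1 come from; the numerator θE of the path series gives the first
-- part its weight μ. The final coefficients have to be natural numbers, so the calculation takes
-- place over a semiring with cancellative addition, where neither E - θE nor 1 / (1 + y_c) exists.
-- Each identity is therefore rearranged until both sides are sums, and each division becomes the
-- cancellation of a common term or of a factor 1 + y_c.

-- Formal power series over a commutative semiring

module PowerSeries {c ℓ} (R : CommutativeSemiring c ℓ) where

  open CommutativeSemiring R
  open Algebra.Definitions _≈_ using (LeftCancellative)
  open Algebra.Solver.Ring.NaturalCoefficients.Default R using (solve; _:=_; _:+_; _:*_)
  open Relation.Binary.Reasoning.Setoid setoid

  Series : Set c
  Series = ℕ → Carrier

  -- A record, so that the two series can be inferred from a proof of equality.
  infix 4 _≋_
  record _≋_ (f g : Series) : Set ℓ where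
    constructor coefficientwise
    field coeff : ∀ k → f k ≈ g k

  open _≋_ public

  infixl 7 _⊛_
  _⊛_ : Series → Series → Series
  (f ⊛ g) zero    = f 0 * g 0
  (f ⊛ g) (suc k) = f 0 * g (suc k) + ((f ∘ suc) ⊛ g) k

  infixl 6 _⊕_
  _⊕_ : Series → Series → Series
  (f ⊕ g) k = f k + g k

  constant : Carrier → Series
  constant a zero    = a
  constant a (suc k) = 0#

  linear : Carrier → Series
  linear a zero    = 0#
  linear a (suc k) = constant a k

  ⊛-cong′ : ∀ {f f′ g g′} → (∀ k → f k ≈ f′ k) → (∀ k → g k ≈ g′ k) → ∀ k → (f ⊛ g) k ≈ (f′ ⊛ g′) k
  ⊛-cong′ p q zero    = *-cong (p 0) (q 0)
  ⊛-cong′ p q (suc k) = +-cong (*-cong (p 0) (q (suc k))) (⊛-cong′ (p ∘ suc) q k)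

  ⊛-zeroˡ : ∀ g k → ((λ _ → 0#) ⊛ g) k ≈ 0#
  ⊛-zeroˡ g zero    = zeroˡ _
  ⊛-zeroˡ g (suc k) = trans (+-cong (zeroˡ _) (⊛-zeroˡ g k)) (+-identityˡ 0#)

  ⊛-constantˡ : ∀ a g k → (constant a ⊛ g) k ≈ a * g k
  ⊛-constantˡ a g zero    = refl
  ⊛-constantˡ a g (suc k) = trans (+-congˡ (⊛-zeroˡ g k)) (+-identityʳ _)

  ⊛-linearˡ-zero : ∀ a g → (linear a ⊛ g) 0 ≈ 0#
  ⊛-linearˡ-zero a g = zeroˡ _

  ⊛-linearˡ-suc : ∀ a g k → (linear a ⊛ g) (suc k) ≈ a * g k
  ⊛-linearˡ-suc a g k = trans (+-cong (zeroˡ _) (⊛-constantˡ a g k)) (+-identityˡ _)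

  ⊛-scaleˡ : ∀ a f g k → ((λ i → a * f i) ⊛ g) k ≈ a * (f ⊛ g) k
  ⊛-scaleˡ a f g zero    = *-assoc _ _ _
  ⊛-scaleˡ a f g (suc k) = trans (+-cong (*-assoc _ _ _) (⊛-scaleˡ a (f ∘ suc) g k)) (sym (distribˡ _ _ _))

  ⊛-distribʳ : ∀ h f g k → ((f ⊕ g) ⊛ h) k ≈ (f ⊛ h) k + (g ⊛ h) k
  ⊛-distribʳ h f g zero    = distribʳ _ _ _
  ⊛-distribʳ h f g (suc k) = begin
    (f 0 + g 0) * h (suc k) + (((f ∘ suc) ⊕ (g ∘ suc)) ⊛ h) k
      ≈⟨ +-congˡ (⊛-distribʳ h (f ∘ suc) (g ∘ suc) k) ⟩
    (f 0 + g 0) * h (suc k) + (((f ∘ suc) ⊛ h) k + ((g ∘ suc) ⊛ h) k)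
      ≈⟨ solve 5 (λ a b x u v → (a :+ b) :* x :+ (u :+ v) := (a :* x :+ u) :+ (b :* x :+ v)) refl _ _ _ _ _ ⟩
    (f ⊛ h) (suc k) + (g ⊛ h) (suc k) ∎

  -- The recursion of `⊛` consumes the left factor only. This mirror image consumes the right one,
  -- which lets the induction for commutativity close.
  ⊛-suc-last : ∀ f g k → (f ⊛ g) (suc k) ≈ (f ⊛ (g ∘ suc)) k + f (suc k) * g 0
  ⊛-suc-last f g zero    = refl
  ⊛-suc-last f g (suc k) = trans (+-congˡ (⊛-suc-last (f ∘ suc) g k)) (sym (+-assoc _ _ _))

  ⊛-comm : ∀ f g k → (f ⊛ g) k ≈ (g ⊛ f) k
  ⊛-comm f g zero    = *-comm _ _
  ⊛-comm f g (suc k) = begin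
    f 0 * g (suc k) + ((f ∘ suc) ⊛ g) k ≈⟨ +-cong (*-comm _ _) (⊛-comm (f ∘ suc) g k) ⟩
    g (suc k) * f 0 + (g ⊛ (f ∘ suc)) k ≈⟨ +-comm _ _ ⟩
    (g ⊛ (f ∘ suc)) k + g (suc k) * f 0 ≈⟨ ⊛-suc-last g f k ⟨
    (g ⊛ f) (suc k)                     ∎

  ⊛-assoc : ∀ f g h k → ((f ⊛ g) ⊛ h) k ≈ (f ⊛ (g ⊛ h)) k
  ⊛-assoc f g h zero    = *-assoc _ _ _
  ⊛-assoc f g h (suc k) = begin
    f 0 * g 0 * h (suc k) + (((λ i → f 0 * g (suc i)) ⊕ ((f ∘ suc) ⊛ g)) ⊛ h) k
      ≈⟨ +-congˡ (⊛-distribʳ h (λ i → f 0 * g (suc i)) ((f ∘ suc) ⊛ g) k) ⟩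
    f 0 * g 0 * h (suc k) + (((λ i → f 0 * g (suc i)) ⊛ h) k + (((f ∘ suc) ⊛ g) ⊛ h) k)
      ≈⟨ +-congˡ (+-cong (⊛-scaleˡ (f 0) (g ∘ suc) h k) (⊛-assoc (f ∘ suc) g h k)) ⟩
    f 0 * g 0 * h (suc k) + (f 0 * ((g ∘ suc) ⊛ h) k + ((f ∘ suc) ⊛ (g ⊛ h)) k)
      ≈⟨ solve 5 (λ a b x u v → a :* b :* x :+ (a :* u :+ v) := a :* (b :* x :+ u) :+ v) refl _ _ _ _ _ ⟩
    (f ⊛ (g ⊛ h)) (suc k) ∎

  series : CommutativeSemiring c ℓ
  series = record
    { Carrier = Series
    ; _≈_     = _≋_
    ; _+_     = _⊕_
    ; _*_     = _⊛_
    ; 0#      = λ _ → 0#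
    ; 1#      = constant 1#
    ; isCommutativeSemiring = isCommutativeSemiringˡ record
      { +-isCommutativeMonoid = record
        { isMonoid = record
          { isSemigroup = record
            { isMagma = record
              { isEquivalence = ≋-isEquivalence
              ; ∙-cong = λ p q → coefficientwise λ k → +-cong (coeff p k) (coeff q k)
              }
            ; assoc = λ f g h → coefficientwise λ k → +-assoc _ _ _
            }
          ; identity = (λ f → coefficientwise λ k → +-identityˡ _) , (λ f → coefficientwise λ k → +-identityʳ _)
          }
        ; comm = λ f g → coefficientwise λ k → +-comm _ _
        }
      ; *-isCommutativeMonoid = record
        { isMonoid = record
          { isSemigroup = record
            { isMagma = record
              { isEquivalence = ≋-isEquivalence
              ; ∙-cong = λ p q → coefficientwise (⊛-cong′ (coeff p) (coeff q))
              }
            ; assoc = λ f g h → coefficientwise (⊛-assoc f g h)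
            }
          ; identity = (λ f → coefficientwise (identityˡ f))
                     , (λ f → coefficientwise λ k → trans (⊛-comm f _ k) (identityˡ f k))
          }
        ; comm = λ f g → coefficientwise (⊛-comm f g)
        }
      ; distribʳ = λ h f g → coefficientwise (⊛-distribʳ h f g)
      ; zeroˡ    = λ g → coefficientwise (⊛-zeroˡ g)
      }
    }
    where
    ≋-isEquivalence : IsEquivalence _≋_
    ≋-isEquivalence = record
      { refl  = coefficientwise λ k → refl
      ; sym   = λ p → coefficientwise λ k → sym (coeff p k)
      ; trans = λ p q → coefficientwise λ k → trans (coeff p k) (coeff q k)
      }

    identityˡ : ∀ f k → (constant 1# ⊛ f) k ≈ f k
    identityˡ f k = trans (⊛-constantˡ 1# f k) (*-identityˡ _)

  1+linear : ∀ a h k → ((constant 1# ⊕ linear a) ⊛ h) k ≈ (linear a ⊛ h) k + h k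
  1+linear a h k = trans (⊛-distribʳ h _ _ k)
    (trans (+-comm _ _) (+-congˡ (trans (⊛-constantˡ 1# h k) (*-identityˡ _))))

  module _ (cancel : LeftCancellative _+_) where

    ⊕-cancelˡ : Algebra.Definitions.LeftCancellative _≋_ _⊕_
    ⊕-cancelˡ f g h p = coefficientwise λ k → cancel (f k) (g k) (h k) (coeff p k)

    -- The substitute for dividing by 1 + az. In degree k + 1 the hypothesis reads a f_k + f_{k+1} =
    -- a g_k + g_{k+1}, so the coefficients can be cancelled one after the other, from degree 0
    -- upwards.
    1+linear-cancelˡ : ∀ a {f g} → (constant 1# ⊕ linear a) ⊛ f ≋ (constant 1# ⊕ linear a) ⊛ g → f ≋ g
    1+linear-cancelˡ a {f} {g} p = coefficientwise go
      where
      q : ∀ k → (linear a ⊛ f) k + f k ≈ (linear a ⊛ g) k + g k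
      q k = trans (sym (1+linear a f k)) (trans (coeff p k) (1+linear a g k))

      go : ∀ k → f k ≈ g k
      go zero    = cancel _ _ _ (trans (+-congʳ (trans (⊛-linearˡ-zero a g) (sym (⊛-linearˡ-zero a f)))) (q 0))
      go (suc k) = cancel _ _ _ (trans (+-congʳ same) (q (suc k)))
        where
        same : (linear a ⊛ g) (suc k) ≈ (linear a ⊛ f) (suc k)
        same = trans (⊛-linearˡ-suc a g k) (trans (*-congˡ (sym (go k))) (sym (⊛-linearˡ-suc a f k)))

-- Elementary symmetric functions and the Euler operator

module Elementary {c ℓ} (R : CommutativeSemiring c ℓ) where

  private module R = CommutativeSemiring R
  open Algebra.Properties.Semiring.Mult R.semiring using () renaming (_×_ to _·_)
  private module RS = Algebra.Solver.Ring.NaturalCoefficients.Default R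
  open PowerSeries R
  open CommutativeSemiring series hiding (zero)
  open Algebra.Properties.Semiring.Sum semiring
    using (sum; sum-cong-≋; ∑-distrib-+; *-distribˡ-sum)
  open Algebra.Solver.Ring.NaturalCoefficients.Default series using (solve; _:=_; _:+_; _:*_; con)
  open Relation.Binary.Reasoning.Setoid setoid

  ι : ℕ → R.Carrier
  ι k = k · R.1#

  -- The Euler operator z d/dz.
  θ : Series → Series
  θ f k = ι k R.* f k

  θ-cong : ∀ {f g} → f ≈ g → θ f ≈ θ g
  θ-cong p = coefficientwise λ k → R.*-congˡ (coeff p k)

  θ-+ : ∀ f g → θ (f + g) ≈ θ f + θ g
  θ-+ f g = coefficientwise λ k → R.distribˡ _ _ _

  θ-1 : θ 1# ≈ 0#
  θ-1 = coefficientwise λ where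
    zero    → R.zeroˡ _
    (suc k) → R.zeroʳ _

  θ-linear : ∀ a f → θ (linear a * f) ≈ linear a * f + linear a * θ f
  θ-linear a f = coefficientwise λ where
    zero    → R.trans (R.zeroˡ _) (R.sym (R.trans (R.+-cong (⊛-linearˡ-zero a f) (⊛-linearˡ-zero a (θ f))) (R.+-identityˡ _)))
    (suc k) → R.trans (R.*-congˡ (⊛-linearˡ-suc a f k))
      (R.trans (RS.solve 3 (λ i a f → (RS.con 1 RS.:+ i) RS.:* (a RS.:* f) RS.:= a RS.:* f RS.:+ a RS.:* (i RS.:* f)) R.refl (ι k) a (f k))
        (R.sym (R.+-cong (⊛-linearˡ-suc a f k) (⊛-linearˡ-suc a (θ f) k))))

  E : ∀ {n} → (Fin n → R.Carrier) → Series
  E {zero}  x = 1#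
  E {suc n} x = (1# + linear (x zero)) * E (x ∘ suc)

  -- For i ≠ j, E₁ x i and E₂ x i j are the parts of E x divisible by x i and by x i * x j.
  E₁ : ∀ {n} → (Fin n → R.Carrier) → Fin n → Series
  E₁ x zero    = linear (x zero) * E (x ∘ suc)
  E₁ x (suc i) = (1# + linear (x zero)) * E₁ (x ∘ suc) i

  E₂ : ∀ {n} → (Fin n → R.Carrier) → Fin n → Fin n → Series
  E₂ x zero    zero    = 0#
  E₂ x zero    (suc j) = linear (x zero) * E₁ (x ∘ suc) j
  E₂ x (suc i) zero    = linear (x zero) * E₁ (x ∘ suc) i
  E₂ x (suc i) (suc j) = (1# + linear (x zero)) * E₂ (x ∘ suc) i j

  E-zero : ∀ {n} (x : Fin n → R.Carrier) → E x 0 R.≈ R.1#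
  E-zero {zero}  x = R.refl
  E-zero {suc n} x = R.trans (R.*-cong (R.+-identityʳ _) (E-zero (x ∘ suc))) (R.*-identityˡ _)

  -- `E₁ x i` arises from `E x` by replacing the factor 1 + y_i with y_i, where y_i is
  -- `linear (x i)`. This is E₁ = y_i E / (1 + y_i) without denominators.
  E₁-factor : ∀ {n} (x : Fin n → R.Carrier) i → (1# + linear (x i)) * E₁ x i ≈ linear (x i) * E x
  E₁-factor x zero    = solve 3 (λ a y e → (a :+ y) :* (y :* e) := y :* ((a :+ y) :* e)) refl _ _ _
  E₁-factor x (suc i) = begin
    (1# + linear (x (suc i))) * ((1# + linear (x zero)) * E₁ (x ∘ suc) i)
      ≈⟨ solve 3 (λ a b e → a :* (b :* e) := b :* (a :* e)) refl _ _ _ ⟩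
    (1# + linear (x zero)) * ((1# + linear (x (suc i))) * E₁ (x ∘ suc) i)
      ≈⟨ *-congˡ (E₁-factor (x ∘ suc) i) ⟩
    (1# + linear (x zero)) * (linear (x (suc i)) * E (x ∘ suc))
      ≈⟨ solve 3 (λ a b e → a :* (b :* e) := b :* (a :* e)) refl _ _ _ ⟩
    linear (x (suc i)) * ((1# + linear (x zero)) * E (x ∘ suc)) ∎

  E₂-factor : ∀ {n} (x : Fin n → R.Carrier) i j → (i =ᶠ j) ≡ false →
              (1# + linear (x i)) * E₂ x i j ≈ linear (x i) * E₁ x j
  E₂-factor x zero    (suc j) _  = solve 3 (λ a y e → (a :+ y) :* (y :* e) := y :* ((a :+ y) :* e)) refl _ _ _
  E₂-factor x (suc i) zero    _  = begin
    (1# + linear (x (suc i))) * (linear (x zero) * E₁ (x ∘ suc) i)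
      ≈⟨ solve 3 (λ a b e → a :* (b :* e) := b :* (a :* e)) refl _ _ _ ⟩
    linear (x zero) * ((1# + linear (x (suc i))) * E₁ (x ∘ suc) i)
      ≈⟨ *-congˡ (E₁-factor (x ∘ suc) i) ⟩
    linear (x zero) * (linear (x (suc i)) * E (x ∘ suc))
      ≈⟨ solve 3 (λ a b e → a :* (b :* e) := b :* (a :* e)) refl _ _ _ ⟩
    linear (x (suc i)) * (linear (x zero) * E (x ∘ suc)) ∎
  E₂-factor x (suc i) (suc j) ne = begin
    (1# + linear (x (suc i))) * ((1# + linear (x zero)) * E₂ (x ∘ suc) i j)
      ≈⟨ solve 3 (λ a b e → a :* (b :* e) := b :* (a :* e)) refl _ _ _ ⟩
    (1# + linear (x zero)) * ((1# + linear (x (suc i))) * E₂ (x ∘ suc) i j)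
      ≈⟨ *-congˡ (E₂-factor (x ∘ suc) i j ne) ⟩
    (1# + linear (x zero)) * (linear (x (suc i)) * E₁ (x ∘ suc) j)
      ≈⟨ solve 3 (λ a b e → a :* (b :* e) := b :* (a :* e)) refl _ _ _ ⟩
    linear (x (suc i)) * ((1# + linear (x zero)) * E₁ (x ∘ suc) j) ∎

  -- The diagonal of `E₂` is 0 by convention, so that a double sum over all i and j counts exactly
  -- the pairs of distinct variables.
  E₂-diagonal : ∀ {n} (x : Fin n → R.Carrier) i j → (i =ᶠ j) ≡ true → E₂ x i j ≈ 0#
  E₂-diagonal x zero    zero    _  = refl
  E₂-diagonal x (suc i) (suc j) eq = trans (*-congˡ (E₂-diagonal (x ∘ suc) i j eq)) (zeroʳ _)

  θ-product : ∀ a f → θ ((1# + linear a) * f) ≈ linear a * f + (1# + linear a) * θ f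
  θ-product a f = begin
    θ ((1# + linear a) * f)                  ≈⟨ θ-cong (trans (distribʳ _ _ _) (+-congʳ (*-identityˡ f))) ⟩
    θ (f + linear a * f)                     ≈⟨ θ-+ _ _ ⟩
    θ f + θ (linear a * f)                   ≈⟨ +-congˡ (θ-linear a f) ⟩
    θ f + (linear a * f + linear a * θ f)
      ≈⟨ solve 3 (λ f y g → g :+ (y :* f :+ y :* g) := y :* f :+ (con 1 :+ y) :* g) refl f (linear a) (θ f) ⟩
    linear a * f + (1# + linear a) * θ f     ∎

  -- A squarefree monomial of degree k is counted once for each of its k variables.
  sum-E₁ : ∀ {n} (x : Fin n → R.Carrier) → sum (E₁ x) ≈ θ (E x)
  sum-E₁ {zero}  x = sym θ-1
  sum-E₁ {suc n} x = begin
    linear (x zero) * E (x ∘ suc) + sum (λ i → (1# + linear (x zero)) * E₁ (x ∘ suc) i)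
      ≈⟨ +-congˡ (*-distribˡ-sum _ (E₁ (x ∘ suc))) ⟨
    linear (x zero) * E (x ∘ suc) + (1# + linear (x zero)) * sum (E₁ (x ∘ suc))
      ≈⟨ +-congˡ (*-congˡ (sum-E₁ (x ∘ suc))) ⟩
    linear (x zero) * E (x ∘ suc) + (1# + linear (x zero)) * θ (E (x ∘ suc))
      ≈⟨ θ-product (x zero) (E (x ∘ suc)) ⟨
    θ (E x) ∎

  -- A squarefree monomial of degree k contains k (k - 1) ordered pairs of distinct variables; the
  -- summand `θ (E x)` raises this to k² and so avoids a subtraction.
  sum-E₂ : ∀ {n} (x : Fin n → R.Carrier) → sum (λ i → sum (E₂ x i)) + θ (E x) ≈ θ (θ (E x))
  sum-E₂ {zero}  x = begin
    0# + θ 1#  ≈⟨ +-identityˡ _ ⟩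
    θ 1#       ≈⟨ θ-1 ⟩
    0#         ≈⟨ coefficientwise (λ k → R.sym (R.zeroʳ _)) ⟩
    θ 0#       ≈⟨ θ-cong θ-1 ⟨
    θ (θ 1#)   ∎
  sum-E₂ {suc n} x = begin
    sum (λ i → sum (E₂ x i)) + θ (E x)
      ≈⟨ +-cong (+-cong (trans (+-identityˡ _) first) rest) (θ-product (x zero) (E x′)) ⟩
    y * θ (E x′) + (y * θ (E x′) + (1# + y) * Σ₂) + (y * E x′ + (1# + y) * θ (E x′))
      ≈⟨ solve 4 (λ y e f s → (y :* f :+ (y :* f :+ (con 1 :+ y) :* s)) :+ (y :* e :+ (con 1 :+ y) :* f)
                  := (y :* e :+ y :* f) :+ (y :* f :+ (con 1 :+ y) :* (s :+ f))) refl y (E x′) (θ (E x′)) Σ₂ ⟩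
    (y * E x′ + y * θ (E x′)) + (y * θ (E x′) + (1# + y) * (Σ₂ + θ (E x′)))
      ≈⟨ +-congˡ (+-congˡ (*-congˡ (sum-E₂ x′))) ⟩
    (y * E x′ + y * θ (E x′)) + (y * θ (E x′) + (1# + y) * θ (θ (E x′)))
      ≈⟨ +-cong (θ-linear (x zero) (E x′)) (θ-product (x zero) (θ (E x′))) ⟨
    θ (y * E x′) + θ ((1# + y) * θ (E x′))
      ≈⟨ θ-+ _ _ ⟨
    θ (y * E x′ + (1# + y) * θ (E x′))
      ≈⟨ θ-cong (θ-product (x zero) (E x′)) ⟨
    θ (θ (E x)) ∎
    where
    x′ = x ∘ suc
    y  = linear (x zero)
    Σ₂ = sum (λ i → sum (E₂ x′ i))

    first : sum (λ j → y * E₁ x′ j) ≈ y * θ (E x′)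
    first = trans (sym (*-distribˡ-sum y (E₁ x′))) (*-congˡ (sum-E₁ x′))

    rest : sum (λ i → y * E₁ x′ i + sum (λ j → (1# + y) * E₂ x′ i j)) ≈ y * θ (E x′) + (1# + y) * Σ₂
    rest = begin
      sum (λ i → y * E₁ x′ i + sum (λ j → (1# + y) * E₂ x′ i j))
        ≈⟨ ∑-distrib-+ (λ i → y * E₁ x′ i) (λ i → sum (λ j → (1# + y) * E₂ x′ i j)) ⟩
      sum (λ i → y * E₁ x′ i) + sum (λ i → sum (λ j → (1# + y) * E₂ x′ i j))
        ≈⟨ +-cong first (sum-cong-≋ (λ i → sym (*-distribˡ-sum (1# + y) (E₂ x′ i)))) ⟩
      y * θ (E x′) + sum (λ i → (1# + y) * sum (E₂ x′ i))
        ≈⟨ +-congˡ (*-distribˡ-sum (1# + y) (λ i → sum (E₂ x′ i))) ⟨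
      y * θ (E x′) + (1# + y) * Σ₂ ∎

-- Equality of colours and Kronecker symbols

=ᶠ-sym : ∀ {n} (i j : Fin n) → (i =ᶠ j) ≡ (j =ᶠ i)
=ᶠ-sym zero    zero    = ≡.refl
=ᶠ-sym zero    (suc j) = ≡.refl
=ᶠ-sym (suc i) zero    = ≡.refl
=ᶠ-sym (suc i) (suc j) = =ᶠ-sym i j

module Kronecker {c ℓ} (R : CommutativeSemiring c ℓ) where

  open CommutativeSemiring R hiding (zero)
  open Algebra.Properties.Semiring.Sum semiring using (sum; sum-cong-≋; sum-replicate-zero)

  δ ν : ∀ {n} → Fin n → Fin n → Carrier
  δ i j = if i =ᶠ j then 1# else 0#
  ν i j = if i =ᶠ j then 0# else 1#

  δ-sym : ∀ {n} (i j : Fin n) → δ i j ≈ δ j i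
  δ-sym i j rewrite =ᶠ-sym i j = refl

  ν-sym : ∀ {n} (i j : Fin n) → ν i j ≈ ν j i
  ν-sym i j rewrite =ᶠ-sym i j = refl

  ν+δ : ∀ {n} (i j : Fin n) → ν i j + δ i j ≈ 1#
  ν+δ i j with i =ᶠ j
  ... | true  = +-identityˡ 1#
  ... | false = +-identityʳ 1#

  sum-zero : ∀ {n} {f : Fin n → Carrier} → (∀ i → f i ≈ 0#) → sum f ≈ 0#
  sum-zero {n} p = trans (sum-cong-≋ p) (sum-replicate-zero n)

  sum-δ : ∀ {n} (i : Fin n) (f : Fin n → Carrier) → sum (λ j → δ i j * f j) ≈ f i
  sum-δ zero    f = trans (+-cong (*-identityˡ _) (sum-zero (λ j → zeroˡ (f (suc j))))) (+-identityʳ _)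
  sum-δ (suc i) f = trans (+-cong (zeroˡ _) (sum-δ i (f ∘ suc))) (+-identityˡ _)

-- Solving linear equations without subtraction or division

module LinearEquations {c ℓ} (S : CommutativeSemiring c ℓ) where

  open CommutativeSemiring S hiding (zero)
  open Algebra.Definitions _≈_ using (LeftCancellative)
  open Algebra.Solver.Ring.NaturalCoefficients.Default S using (solve; _:=_; _:+_; _:*_; con)
  open Algebra.Properties.Semiring.Sum semiring
    using (sum; sum-cong-≋; ∑-distrib-+; *-distribˡ-sum; *-distribʳ-sum)
  open Relation.Binary.Reasoning.Setoid setoid

  -- Both z / w and b / a equal the fraction y / u, hence a z = b w. The factor u stays on both
  -- sides, to be cancelled where it is known to be 1 + y.
  cross-multiply : ∀ {u y z w a b} → u * z ≈ y * w → u * b ≈ y * a → u * (a * z) ≈ u * (b * w)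
  cross-multiply {u} {y} {z} {w} {a} {b} p q = begin
    u * (a * z)  ≈⟨ solve 3 (λ u a z → u :* (a :* z) := a :* (u :* z)) refl u a z ⟩
    a * (u * z)  ≈⟨ *-congˡ p ⟩
    a * (y * w)  ≈⟨ solve 3 (λ y a w → a :* (y :* w) := (y :* a) :* w) refl y a w ⟩
    (y * a) * w  ≈⟨ *-congʳ q ⟨
    (u * b) * w  ≈⟨ *-assoc u b w ⟩
    u * (b * w)  ∎

  substitute : ∀ {u y z s f d b} → u * z ≈ y * s → s ≈ f * d → u * b ≈ y * d → u * z ≈ u * (f * b)
  substitute {u} {y} {z} {s} {f} {d} {b} p q r = begin
    u * z        ≈⟨ p ⟩
    y * s        ≈⟨ *-congˡ q ⟩
    y * (f * d)  ≈⟨ solve 3 (λ y f d → y :* (f :* d) := f :* (y :* d)) refl y f d ⟩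
    f * (y * d)  ≈⟨ *-congˡ r ⟨
    f * (u * b)  ≈⟨ solve 3 (λ u f b → f :* (u :* b) := u :* (f :* b)) refl u f b ⟩
    u * (f * b)  ∎

  sum-distribute : ∀ {n g s} (z a h : Fin n → Carrier) → (∀ i → g * z i ≈ a i * (h i + s)) →
                   g * sum z ≈ sum (λ i → a i * h i) + sum a * s
  sum-distribute {g = g} {s} z a h p = begin
    g * sum z                                   ≈⟨ *-distribˡ-sum g z ⟩
    sum (λ i → g * z i)                         ≈⟨ sum-cong-≋ (λ i → trans (p i) (distribˡ (a i) (h i) s)) ⟩
    sum (λ i → a i * h i + a i * s)             ≈⟨ ∑-distrib-+ (λ i → a i * h i) (λ i → a i * s) ⟩
    sum (λ i → a i * h i) + sum (λ i → a i * s) ≈⟨ +-congˡ (*-distribʳ-sum s a) ⟨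
    sum (λ i → a i * h i) + sum a * s           ∎

  module _ (cancel : LeftCancellative _+_) where

    transfer : ∀ {g a t d s} → g + a ≈ t + 1# → g * s ≈ d + t * s → s ≈ d + a * s
    transfer {g} {a} {t} {d} {s} p q = cancel (t * s) s (d + a * s) (begin
      t * s + s           ≈⟨ solve 2 (λ t s → t :* s :+ s := (t :+ con 1) :* s) refl t s ⟩
      (t + 1#) * s        ≈⟨ *-congʳ p ⟨
      (g + a) * s         ≈⟨ distribʳ s g a ⟩
      g * s + a * s       ≈⟨ +-congʳ q ⟩
      d + t * s + a * s   ≈⟨ solve 3 (λ d t a → d :+ t :+ a := t :+ (d :+ a)) refl d (t * s) (a * s) ⟩
      t * s + (d + a * s) ∎)

    -- Here f plays the role of 1 / (1 - a). Adding a f s to both sides makes the claim provable by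
    -- expansion alone.
    fixpoint-solution : ∀ {f a d s} → f ≈ 1# + a * f → s ≈ d + a * s → s ≈ f * d
    fixpoint-solution {f} {a} {d} {s} p q = cancel (a * f * s) s (f * d) (begin
      a * f * s + s       ≈⟨ solve 2 (λ t s → t :* s :+ s := (con 1 :+ t) :* s) refl (a * f) s ⟩
      (1# + a * f) * s    ≈⟨ *-congʳ p ⟨
      f * s               ≈⟨ *-congˡ q ⟩
      f * (d + a * s)     ≈⟨ solve 4 (λ f d a s → f :* (d :+ a :* s) := a :* f :* s :+ f :* d) refl f d a s ⟩
      a * f * s + f * d   ∎)

-- Weighted compositions and their sorting into partitions

IsComposition : ℕ → List ℕ → Set
IsComposition d λs = All (_≥ 1) λs × sumℕ λs ≡ d

prepend : ℕ → ℕ → List (List ℕ × ℕ) → List (List ℕ × ℕ)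
prepend k w = map (λ (λs , w′) → k ∷ λs , w *ℕ w′)

-- All compositions of o + k + 1 with first part o + i + 1 ≥ o + 1; the weight of a
-- composition is w i times the product of μ - 1 over its other parts μ.
quotientTerms : (ℕ → ℕ) → ℕ → ℕ → List (List ℕ × ℕ)
quotientTerms w o zero    = (suc o ∷ [] , w 0) ∷ []
quotientTerms w o (suc k) = prepend (suc o) (w 0) (quotientTerms id 0 k) ++ quotientTerms (w ∘ suc) (suc o) k

-- The same compositions, now of o + s + k + 1, with the weight multiplied by the
-- amount by which the first partial sum exceeding o + s exceeds o + s + 1.
tadpoleTerms : (ℕ → ℕ) → ℕ → ℕ → ℕ → List (List ℕ × ℕ)
tadpoleTerms w o zero    k = quotientTerms (λ i → i *ℕ w i) o k
tadpoleTerms w o (suc s) k = prepend (suc o) (w 0) (tadpoleTerms id 0 s k) ++ tadpoleTerms (w ∘ suc) (suc o) s k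

prepend-compositions : ∀ {d k} w {ts} → All (λ t → IsComposition d (proj₁ t)) ts →
                       All (λ t → IsComposition (suc k +ℕ d) (proj₁ t)) (prepend (suc k) w ts)
prepend-compositions {k = k} w ps = map⁺ (All.map (λ (pos , eq) → s≤s z≤n ∷ pos , ≡.cong (suc k +ℕ_) eq) ps)

quotientTerms-compositions : ∀ w o k → All (λ t → IsComposition (suc (o +ℕ k)) (proj₁ t)) (quotientTerms w o k)
quotientTerms-compositions w o zero    = (s≤s z≤n ∷ [] , ≡.refl) ∷ []
quotientTerms-compositions w o (suc k) = ++⁺ (prepend-compositions (w 0) (quotientTerms-compositions id 0 k))
  (≡.subst (λ d → All (λ t → IsComposition d (proj₁ t)) (quotientTerms (w ∘ suc) (suc o) k))
    (≡.cong suc (≡.sym (ℕ.+-suc o k))) (quotientTerms-compositions (w ∘ suc) (suc o) k))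

tadpoleTerms-compositions : ∀ w o s k → All (λ t → IsComposition (suc (o +ℕ (s +ℕ k))) (proj₁ t)) (tadpoleTerms w o s k)
tadpoleTerms-compositions w o zero    k = quotientTerms-compositions (λ i → i *ℕ w i) o k
tadpoleTerms-compositions w o (suc s) k = ++⁺ (prepend-compositions (w 0) (tadpoleTerms-compositions id 0 s k))
  (≡.subst (λ d → All (λ t → IsComposition d (proj₁ t)) (tadpoleTerms (w ∘ suc) (suc o) s k))
    (≡.cong suc (≡.sym (ℕ.+-suc o (s +ℕ k)))) (tadpoleTerms-compositions (w ∘ suc) (suc o) s k))

-- The order on ℕ is flipped, so that sorted lists are weakly decreasing.
open Data.List.Sort (decTotalOrder ℕ.≤-decTotalOrder) using (sort; sort-↭; sort-↗)

-- Compositions with the same parts remain separate entries: the list in `EPositive` may repeat a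
-- partition, and the weights then add up.
sortTerms : List (List ℕ × ℕ) → List (List ℕ × ℕ)
sortTerms = map (λ (λs , w) → sort λs , w)

sortTerms-partitions : ∀ {d ts} → All (λ t → IsComposition d (proj₁ t)) ts →
                       All (λ t → IsPartition d (proj₁ t)) (sortTerms ts)
sortTerms-partitions ps = map⁺ (All.map (λ {t} → partition (proj₁ t)) ps)
  where
  decreasing : ∀ {λs} → Linked _≥_ λs → Decreasing λs
  decreasing []       = []
  decreasing [-]      = [-]
  decreasing (p ∷ ps) = p ∷ decreasing ps

  partition : ∀ {d} λs → IsComposition d λs → IsPartition d (sort λs)
  partition λs (pos , eq) =
    All-resp-↭ (↭-sym (sort-↭ λs)) pos , decreasing (sort-↗ λs) , ≡.trans (sum-↭ (sort-↭ λs)) eq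

-- Words with distinct neighbours: paths and cycles

module Words {c ℓ} (R : CommutativeSemiring c ℓ)
  (cancel : Algebra.Definitions.LeftCancellative (CommutativeSemiring._≈_ R) (CommutativeSemiring._+_ R))
  {n : ℕ} (x : Fin n → CommutativeSemiring.Carrier R) where

  open CommutativeSemiring R hiding (zero)
  open Algebra.Properties.Semiring.Sum semiring
    using (sum; sum-cong-≋; ∑-distrib-+; ∑-comm; *-distribˡ-sum; *-distribʳ-sum)
  open Algebra.Solver.Ring.NaturalCoefficients.Default R using (solve; _:=_; _:+_; _:*_; con)
  open Relation.Binary.Reasoning.Setoid setoid
  open PowerSeries R
  open Elementary R
  open Algebra.Properties.Semiring.Mult semiring using (×1-homo-*)
  open Kronecker R
  open LinearEquations series
  private
    module S = CommutativeSemiring series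
    module SΣ = Algebra.Properties.Semiring.Sum S.semiring

  e : ℕ → Carrier
  e = E x

  -- Z k i h sums x^v * h(v_{k+1}) over the words v_1 … v_{k+1} with v_1 = i
  -- and distinct neighbours.
  Z : ℕ → Fin n → (Fin n → Carrier) → Carrier
  Z zero    i h = x i * h i
  Z (suc k) i h = x i * sum (λ j → ν i j * Z k j h)

  -- sum-cong-≋ with the length fixed, which inference needs.
  sum-cong : {f g : Fin n → Carrier} → (∀ i → f i ≈ g i) → sum f ≈ sum g
  sum-cong = sum-cong-≋

  sum-ν : ∀ i (f : Fin n → Carrier) → sum (λ j → ν i j * f j) + f i ≈ sum f
  sum-ν i f = begin
    sum (λ j → ν i j * f j) + f i                          ≈⟨ +-congˡ (sum-δ i f) ⟨
    sum (λ j → ν i j * f j) + sum (λ j → δ i j * f j)      ≈⟨ ∑-distrib-+ (λ j → ν i j * f j) (λ j → δ i j * f j) ⟨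
    sum (λ j → ν i j * f j + δ i j * f j)                  ≈⟨ sum-cong (λ j → trans (sym (distribʳ _ _ _)) (trans (*-congʳ (ν+δ i j)) (*-identityˡ _))) ⟩
    sum f                                                  ∎

  -- The added term supplies the words whose second letter repeats i, after which the second letter
  -- is unrestricted.
  Z-suc : ∀ k i h → Z (suc k) i h + x i * Z k i h ≈ x i * sum (λ j → Z k j h)
  Z-suc k i h = trans (sym (distribˡ _ _ _)) (*-congˡ (sum-ν i (λ j → Z k j h)))

  -- Sorts the words by their last letter j, the place where a cycle is closed and a tail is
  -- attached.
  Z-linear : ∀ k i h → Z k i h ≈ sum (λ j → Z k i (δ j) * h j)
  Z-linear zero    i h = begin
    x i * h i                       ≈⟨ *-congˡ (sum-δ i h) ⟨
    x i * sum (λ j → δ i j * h j)   ≈⟨ *-distribˡ-sum (x i) (λ j → δ i j * h j) ⟩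
    sum (λ j → x i * (δ i j * h j)) ≈⟨ sum-cong (λ j → trans (sym (*-assoc _ _ _)) (*-congʳ (*-congˡ (δ-sym i j)))) ⟩
    sum (λ j → x i * δ j i * h j)   ∎
  Z-linear (suc k) i h = begin
    x i * sum (λ l → ν i l * Z k l h)
      ≈⟨ *-congˡ (sum-cong (λ l → trans (*-congˡ (Z-linear k l h)) (trans (*-distribˡ-sum (ν i l) (λ j → Z k l (δ j) * h j)) (sum-cong (λ j → sym (*-assoc _ _ _)))))) ⟩
    x i * sum (λ l → sum (λ j → ν i l * Z k l (δ j) * h j))
      ≈⟨ *-congˡ (∑-comm (λ l j → ν i l * Z k l (δ j) * h j)) ⟩
    x i * sum (λ j → sum (λ l → ν i l * Z k l (δ j) * h j))
      ≈⟨ *-distribˡ-sum (x i) (λ j → sum (λ l → ν i l * Z k l (δ j) * h j)) ⟩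
    sum (λ j → x i * sum (λ l → ν i l * Z k l (δ j) * h j))
      ≈⟨ sum-cong (λ j → trans (*-congˡ (sym (*-distribʳ-sum (h j) (λ l → ν i l * Z k l (δ j))))) (sym (*-assoc _ _ _))) ⟩
    sum (λ j → Z (suc k) i (δ j) * h j) ∎

  -- In w_I a part i + 1 carries the weight i when it is not the first, which is `A i`, and i + 1
  -- when it is the first, which is `B i`.
  A : ℕ → Carrier
  A i = ι i * e (suc i)

  B : ℕ → Carrier
  B i = ι (suc i) * e (suc i)

  -- The coefficients of u(z) / (1 - z A(z)).
  G : (ℕ → Carrier) → ℕ → Carrier
  G u zero    = u 0
  G u (suc k) = u 0 * G A k + G (u ∘ suc) k

  -- The inverse of 1 - zA. Taking its coefficients from `G A` avoids the circularity of F = 1 +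
  -- zAF, and `G u` then turns out to be the product of u and `F`.
  F : Series
  F zero    = 1#
  F (suc k) = G A k

  G-⊛ : ∀ u k → G u k ≈ (u ⊛ F) k
  G-⊛ u zero    = sym (*-identityʳ _)
  G-⊛ u (suc k) = +-congˡ (G-⊛ (u ∘ suc) k)

  G-cong : ∀ {u v} → (∀ i → u i ≈ v i) → ∀ k → G u k ≈ G v k
  G-cong p zero    = p 0
  G-cong p (suc k) = +-cong (*-congʳ (p 0)) (G-cong (p ∘ suc) k)

  G-+ : ∀ u v k → G (λ i → u i + v i) k ≈ G u k + G v k
  G-+ u v zero    = refl
  G-+ u v (suc k) = trans (+-congˡ (G-+ (u ∘ suc) (v ∘ suc) k))
    (solve 5 (λ a b g p q → (a :+ b) :* g :+ (p :+ q) := (a :* g :+ p) :+ (b :* g :+ q)) refl _ _ _ _ _)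

  shifted : (ℕ → Carrier) → Series
  shifted u zero    = 0#
  shifted u (suc k) = u k

  shifted-⊛ : ∀ u f k → (shifted u ⊛ f) (suc k) ≈ (u ⊛ f) k
  shifted-⊛ u f k = trans (+-congʳ (zeroˡ _)) (+-identityˡ _)

  F-fixpoint : F ≋ S.1# S.+ shifted A S.* F
  F-fixpoint = coefficientwise λ where
    zero    → sym (trans (+-congˡ (zeroˡ _)) (+-identityʳ _))
    (suc k) → trans (G-⊛ A k) (sym (trans (+-identityˡ _) (shifted-⊛ A F k)))

  -- The equation E - θE = 1 - zA in subtraction-free form: e_{k+1} + k e_{k+1} = (k + 1) e_{k+1}.
  E+A : E x S.+ shifted A ≋ θ (E x) S.+ S.1#
  E+A = coefficientwise λ where
    zero    → trans (+-identityʳ _) (trans (E-zero x) (sym (trans (+-congʳ (zeroˡ _)) (+-identityˡ _))))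
    (suc k) → solve 2 (λ i a → a :+ i :* a := (con 1 :+ i) :* a :+ con 0) refl (ι k) (e (suc k))

  sum-coeff : ∀ {m} (f : Fin m → Series) k → SΣ.sum f k ≈ sum (λ i → f i k)
  sum-coeff {zero}  f k = refl
  sum-coeff {suc m} f k = +-congˡ (sum-coeff (f ∘ suc) k)

  -- Here `h` weighs the last letter: the constant 1 gives paths, and `δ j` gives the words that end
  -- in j. The shift in `ζ` makes the exponent of z the length of the word.
  module Endpoint (h : Fin n → Carrier) where

    ζ : Fin n → Series
    ζ i = shifted (λ k → Z k i h)

    σ : Series
    σ = SΣ.sum ζ

    D : Series
    D = SΣ.sum (λ i → E₁ x i S.* constant (h i))

    -- From degree 2 on this is `Z-suc`. In degree 1 the only word is i itself, whence the
    -- inhomogeneous term `h i`.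
    ζ-equation : ∀ i → (S.1# S.+ linear (x i)) S.* ζ i ≋ linear (x i) S.* (constant (h i) S.+ σ)
    ζ-equation i = S.trans (S.distribʳ _ _ _) (S.trans (S.+-congʳ (S.*-identityˡ _)) (coefficientwise go))
      where
      go : ∀ k → ζ i k + (linear (x i) ⊛ ζ i) k ≈ (linear (x i) ⊛ (constant (h i) ⊕ σ)) k
      go zero = trans (+-identityˡ _) (trans (⊛-linearˡ-zero (x i) (ζ i)) (sym (⊛-linearˡ-zero (x i) (constant (h i) ⊕ σ))))
      go (suc zero) = begin
        x i * h i + (linear (x i) ⊛ ζ i) 1              ≈⟨ +-congˡ (trans (⊛-linearˡ-suc (x i) (ζ i) 0) (zeroʳ _)) ⟩
        x i * h i + 0#                                  ≈⟨ +-identityʳ _ ⟩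
        x i * h i                                       ≈⟨ *-congˡ (+-identityʳ _) ⟨
        x i * (h i + 0#)                                ≈⟨ *-congˡ (+-congˡ (trans (sum-coeff ζ 0) (sum-zero {n} (λ _ → refl)))) ⟨
        x i * (h i + σ 0)                               ≈⟨ ⊛-linearˡ-suc (x i) (constant (h i) ⊕ σ) 0 ⟨
        (linear (x i) ⊛ (constant (h i) ⊕ σ)) 1         ∎
      go (suc (suc k)) = begin
        Z (suc k) i h + (linear (x i) ⊛ ζ i) (suc (suc k))  ≈⟨ +-congˡ (⊛-linearˡ-suc (x i) (ζ i) (suc k)) ⟩
        Z (suc k) i h + x i * Z k i h                       ≈⟨ Z-suc k i h ⟩
        x i * sum (λ j → Z k j h)                           ≈⟨ *-congˡ (sum-coeff ζ (suc k)) ⟨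
        x i * σ (suc k)                                     ≈⟨ *-congˡ (+-identityˡ _) ⟨
        x i * (0# + σ (suc k))                              ≈⟨ ⊛-linearˡ-suc (x i) (constant (h i) ⊕ σ) (suc k) ⟨
        (linear (x i) ⊛ (constant (h i) ⊕ σ)) (suc (suc k)) ∎

    E*ζ : ∀ i → E x S.* ζ i ≋ E₁ x i S.* (constant (h i) S.+ σ)
    E*ζ i = 1+linear-cancelˡ cancel (x i) (cross-multiply (ζ-equation i) (E₁-factor x i))

    -- Summation over i turns the `E₁ x i` into `θ (E x)`, so the system for the `ζ i` collapses to
    -- one equation for `σ`.
    E*σ : E x S.* σ ≋ D S.+ θ (E x) S.* σ
    E*σ = S.trans (sum-distribute ζ (E₁ x) (λ i → constant (h i)) E*ζ) (S.+-congˡ (S.*-congʳ (sum-E₁ x)))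

    σ≋F*D : σ ≋ F S.* D
    σ≋F*D = fixpoint-solution (⊕-cancelˡ cancel) F-fixpoint
      (transfer (⊕-cancelˡ cancel) E+A E*σ)

  -- p k enumerates the proper colourings of the path with k + 1 vertices.
  p : ℕ → Carrier
  p k = sum (λ i → Z k i (λ _ → 1#))

  p≈G : ∀ k → p k ≈ G B k
  p≈G k = begin
    p k                           ≈⟨ sum-coeff ζ (suc k) ⟨
    σ (suc k)                     ≈⟨ coeff (S.trans σ≋F*D (S.trans (S.*-comm F D) (S.*-congʳ D≋θE))) (suc k) ⟩
    (θ (E x) ⊛ F) (suc k)         ≈⟨ trans (+-congʳ (trans (*-congʳ (zeroˡ _)) (zeroˡ _))) (+-identityˡ _) ⟩
    (B ⊛ F) k                     ≈⟨ G-⊛ B k ⟨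
    G B k                         ∎
    where
    open Endpoint (λ _ → 1#)
    D≋θE : D ≋ θ (E x)
    D≋θE = S.trans (SΣ.sum-cong-≋ (λ i → S.*-identityʳ (E₁ x i))) (sum-E₁ x)

  -- For i ≠ j the inhomogeneous term of `ζ-equation` vanishes, and 1 + y_i times either side is y_i
  -- F E₁, with `E₁` taken at j. For i = j both `ν` and `E₂` are 0.
  ν*Z≋F*E₂ : ∀ i j → constant (ν i j) S.* Endpoint.ζ (δ j) i ≋ F S.* E₂ x i j
  ν*Z≋F*E₂ i j with i =ᶠ j in eq
  ... | true  = S.trans (coefficientwise λ k → trans (⊛-constantˡ 0# (ζ i) k) (zeroˡ _))
                  (S.sym (S.trans (S.*-congˡ (E₂-diagonal x i j eq)) (S.zeroʳ F)))
    where open Endpoint (δ j)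
  ... | false = S.trans (S.*-identityˡ (ζ i)) (1+linear-cancelˡ cancel (x i)
    (substitute (S.trans (ζ-equation i) (S.*-congˡ (S.trans (S.+-congʳ off) (S.+-identityˡ σ))))
      (S.trans σ≋F*D (S.*-congˡ D≋E₁)) (E₂-factor x i j eq)))
    where
    open Endpoint (δ j)

    off : constant (δ j i) ≋ S.0#
    off rewrite ≡.trans (=ᶠ-sym j i) eq = coefficientwise λ where
      zero    → refl
      (suc k) → refl

    D≋E₁ : D ≋ E₁ x j
    D≋E₁ = coefficientwise λ k → trans (sum-coeff (λ i → E₁ x i S.* constant (δ j i)) k)
      (trans (sum-cong (λ i → trans (⊛-comm (E₁ x i) (constant (δ j i)) k) (⊛-constantˡ (δ j i) (E₁ x i) k)))
        (sum-δ j (λ i → E₁ x i k)))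

  -- cyc k enumerates the proper colourings of the cycle with k + 1 vertices.
  cyc : ℕ → Carrier
  cyc k = sum (λ i → sum (λ j → ν i j * Z k i (δ j)))

  -- Summed over both ends, `E₂` becomes θ(θE) - θE, whose coefficient in degree i + 1 is i (i + 1)
  -- e_{i+1}.
  cyc≈G : ∀ k → cyc k ≈ G (λ i → ι i * B i) k
  cyc≈G k = begin
    cyc k
      ≈⟨ sum-cong (λ i → sum-cong (λ j → ⊛-constantˡ (ν i j) (ζ j i) (suc k))) ⟨
    sum (λ i → sum (λ j → (constant (ν i j) ⊛ ζ j i) (suc k)))
      ≈⟨ sum-cong (λ i → sum-cong (λ j → coeff (ν*Z≋F*E₂ i j) (suc k))) ⟩
    sum (λ i → sum (λ j → (F ⊛ E₂ x i j) (suc k)))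
      ≈⟨ sum-cong (λ i → trans (sym (sum-coeff (λ j → F S.* E₂ x i j) (suc k))) (coeff (S.sym (SΣ.*-distribˡ-sum F (E₂ x i))) (suc k))) ⟩
    sum (λ i → (F ⊛ SΣ.sum (E₂ x i)) (suc k))
      ≈⟨ trans (sym (sum-coeff (λ i → F S.* SΣ.sum (E₂ x i)) (suc k))) (coeff (S.sym (SΣ.*-distribˡ-sum F (λ i → SΣ.sum (E₂ x i)))) (suc k)) ⟩
    (F ⊛ Σ₂) (suc k)
      ≈⟨ ⊛-comm F Σ₂ (suc k) ⟩
    (Σ₂ ⊛ F) (suc k)
      ≈⟨ trans (+-congʳ (trans (*-congʳ Σ₂-zero) (zeroˡ _))) (+-identityˡ _) ⟩
    ((Σ₂ ∘ suc) ⊛ F) k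
      ≈⟨ G-⊛ (Σ₂ ∘ suc) k ⟨
    G (Σ₂ ∘ suc) k
      ≈⟨ G-cong Σ₂-suc k ⟩
    G (λ i → ι i * B i) k ∎
    where
    ζ : Fin n → Fin n → Series
    ζ j = Endpoint.ζ (δ j)

    Σ₂ : Series
    Σ₂ = SΣ.sum (λ i → SΣ.sum (E₂ x i))

    Σ₂-zero : Σ₂ 0 ≈ 0#
    Σ₂-zero = trans (sym (+-identityʳ _)) (trans (+-congˡ (sym (zeroˡ _))) (trans (coeff (sum-E₂ x) 0) (zeroˡ _)))

    Σ₂-suc : ∀ i → Σ₂ (suc i) ≈ ι i * B i
    Σ₂-suc i = cancel (B i) _ _ (trans (+-comm _ _) (trans (coeff (sum-E₂ x) (suc i))
      (solve 2 (λ i b → (con 1 :+ i) :* b := b :+ i :* b) refl (ι i) (B i))))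

  -- Tadpoles cut open at the attaching vertex

  -- L b i enumerates the proper colourings of a path with b vertices whose
  -- first colour differs from i.
  L : ℕ → Fin n → Carrier
  L zero    i = 1#
  L (suc b) i = sum (λ j → ν i j * (x j * L b j))

  -- tad k b enumerates the proper colourings of the (k + 1, b)-tadpole.
  tad : ℕ → ℕ → Carrier
  tad k b = sum (λ i → Z k i (λ j → ν i j * L b j))

  Z-one : ∀ b i → Z b i (λ _ → 1#) ≈ x i * L b i
  Z-one zero    i = refl
  Z-one (suc b) i = *-congˡ (sum-cong (λ j → *-congˡ (Z-one b j)))

  Z-L : ∀ k b i → Z (k +ℕ b) i (λ _ → 1#) ≈ Z k i (L b)
  Z-L zero    b i = Z-one b i
  Z-L (suc k) b i = *-congˡ (sum-cong (λ j → *-congˡ (Z-L k b j)))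

  tad≈ : ∀ k b → tad k b ≈ sum (λ i → sum (λ j → ν i j * Z k i (δ j) * L b j))
  tad≈ k b = sum-cong (λ i → trans (Z-linear k i (λ j → ν i j * L b j))
    (sum-cong (λ j → solve 3 (λ z v l → z :* (v :* l) := v :* z :* l) refl (Z k i (δ j)) (ν i j) (L b j))))

  tad-zero : ∀ k → tad k 0 ≈ cyc k
  tad-zero k = trans (tad≈ k 0) (sum-cong (λ i → sum-cong (λ j → *-identityʳ _)))

  -- Enumerates the pairs of a proper colouring of the (k + 1)-cycle and one of
  -- the path with b + 1 vertices such that the cycle ends in the colour in
  -- which the path starts.  Moving this colour to the front of the cycle gives
  -- the colourings of the path that are not colourings of the (k + 2, b)-tadpole.
  glued : ℕ → ℕ → Carrier
  glued k b = sum (λ i → sum (λ j → ν i j * Z k i (δ j) * (x j * L b j)))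

  -- Pairs of a cycle colouring and a path colouring are split by whether the edge joining the two
  -- would be properly coloured.
  tad+glued : ∀ k b → tad k (suc b) + glued k b ≈ cyc k * p b
  tad+glued k b = begin
    tad k (suc b) + glued k b
      ≈⟨ +-congʳ (tad≈ k (suc b)) ⟩
    sum (λ i → sum (λ j → w i j * L (suc b) j)) + glued k b
      ≈⟨ ∑-distrib-+ (λ i → sum (λ j → w i j * L (suc b) j)) (λ i → sum (λ j → w i j * (x j * L b j))) ⟨
    sum (λ i → sum (λ j → w i j * L (suc b) j) + sum (λ j → w i j * (x j * L b j)))
      ≈⟨ sum-cong (λ i → trans (sym (∑-distrib-+ (λ j → w i j * L (suc b) j) (λ j → w i j * (x j * L b j))))
           (sum-cong (λ j → trans (sym (distribˡ _ _ _)) (*-congˡ (total j))))) ⟩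
    sum (λ i → sum (λ j → w i j * p b))
      ≈⟨ sum-cong (λ i → *-distribʳ-sum (p b) (w i)) ⟨
    sum (λ i → sum (w i) * p b)
      ≈⟨ *-distribʳ-sum (p b) (λ i → sum (w i)) ⟨
    cyc k * p b ∎
    where
    w : Fin n → Fin n → Carrier
    w i j = ν i j * Z k i (δ j)

    total : ∀ j → L (suc b) j + x j * L b j ≈ p b
    total j = trans (sum-ν j (λ i → x i * L b i)) (sum-cong (λ i → sym (Z-one b i)))

  -- Colourings of the path are split by whether its vertices 1 and k + 2 differ, that is, whether
  -- the edge closing a (k + 2)-cycle can be added.
  tad-suc+glued : ∀ k b → tad (suc k) b + glued k b ≈ p (suc (k +ℕ b))
  tad-suc+glued k b = begin
    tad (suc k) b + glued k b
      ≈⟨ +-cong (tad≈ (suc k) b) closing ⟩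
    sum (λ i → sum (λ j → ν i j * Z (suc k) i (δ j) * L b j)) + sum (λ i → sum (λ j → δ i j * (Z (suc k) i (δ j) * L b j)))
      ≈⟨ ∑-distrib-+ (λ i → sum (λ j → ν i j * Z (suc k) i (δ j) * L b j)) (λ i → sum (λ j → δ i j * (Z (suc k) i (δ j) * L b j))) ⟨
    sum (λ i → sum (λ j → ν i j * Z (suc k) i (δ j) * L b j) + sum (λ j → δ i j * (Z (suc k) i (δ j) * L b j)))
      ≈⟨ sum-cong (λ i → trans (sym (∑-distrib-+ (λ j → ν i j * Z (suc k) i (δ j) * L b j) (λ j → δ i j * (Z (suc k) i (δ j) * L b j))))
           (sum-cong (λ j → unite i j))) ⟩
    sum (λ i → sum (λ j → Z (suc k) i (δ j) * L b j))
      ≈⟨ sum-cong (λ i → sym (trans (Z-L (suc k) b i) (Z-linear (suc k) i (L b)))) ⟩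
    p (suc (k +ℕ b)) ∎
    where
    unite : ∀ i j → ν i j * Z (suc k) i (δ j) * L b j + δ i j * (Z (suc k) i (δ j) * L b j) ≈ Z (suc k) i (δ j) * L b j
    unite i j = trans (solve 4 (λ v d z l → v :* z :* l :+ d :* (z :* l) := (v :+ d) :* (z :* l)) refl (ν i j) (δ i j) (Z (suc k) i (δ j)) (L b j))
      (trans (*-congʳ (ν+δ i j)) (*-identityˡ _))

    -- The factor `x j` of the first path vertex becomes the first letter of a word of length k + 2
    -- from j to j; its neighbour condition is that of the closing edge, by symmetry of `ν`.
    closing : glued k b ≈ sum (λ i → sum (λ j → δ i j * (Z (suc k) i (δ j) * L b j)))
    closing = begin
      glued k b
        ≈⟨ ∑-comm (λ i j → ν i j * Z k i (δ j) * (x j * L b j)) ⟩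
      sum (λ j → sum (λ i → ν i j * Z k i (δ j) * (x j * L b j)))
        ≈⟨ sum-cong (λ j → trans (sym (*-distribʳ-sum (x j * L b j) (λ i → ν i j * Z k i (δ j))))
             (*-congʳ (sum-cong (λ i → *-congʳ (ν-sym i j))))) ⟩
      sum (λ j → sum (λ i → ν j i * Z k i (δ j)) * (x j * L b j))
        ≈⟨ sum-cong (λ j → solve 3 (λ s y l → s :* (y :* l) := y :* s :* l) refl (sum (λ i → ν j i * Z k i (δ j))) (x j) (L b j)) ⟩
      sum (λ j → Z (suc k) j (δ j) * L b j)
        ≈⟨ sum-cong (λ i → sum-δ i (λ j → Z (suc k) i (δ j) * L b j)) ⟨
      sum (λ i → sum (λ j → δ i j * (Z (suc k) i (δ j) * L b j))) ∎

  -- The tadpole recurrence and its solution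

  tad-recurrence : ∀ k b → tad k (suc b) + p (suc (k +ℕ b)) ≈ tad (suc k) b + cyc k * p b
  tad-recurrence k b = begin
    tad k (suc b) + p (suc (k +ℕ b))             ≈⟨ +-congˡ (tad-suc+glued k b) ⟨
    tad k (suc b) + (tad (suc k) b + glued k b)
      ≈⟨ solve 3 (λ a b c → a :+ (b :+ c) := b :+ (a :+ c)) refl (tad k (suc b)) (tad (suc k) b) (glued k b) ⟩
    tad (suc k) b + (tad k (suc b) + glued k b)  ≈⟨ +-congˡ (tad+glued k b) ⟩
    tad (suc k) b + cyc k * p b                  ∎

  -- The claimed solution as a recursion along the compositions of s + k + 1 with first part
  -- weighted by u. While `s` is positive, one unit is read: either the current part ends, and the
  -- next one starts with the weights `A`, or it grows. At s = 0 the current part reaches i units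
  -- beyond position s + 1, which gives the factor i.
  V : (ℕ → Carrier) → ℕ → ℕ → Carrier
  V u zero    k = G (λ i → ι i * u i) k
  V u (suc s) k = u 0 * V A s k + V (u ∘ suc) s k

  -- Adding `G u` raises the excess of every composition by 1. All the content is in s = 0; for
  -- larger `s` both sides unfold alike, and the instances for `A` and `u ∘ suc` combine linearly.
  V-recurrence : ∀ u s k → V u (suc s) k + G u (suc (s +ℕ k)) ≈ V u s (suc k) + G u s * cyc k
  V-recurrence u zero k = begin
    (u 0 * V A 0 k + V u′ 0 k) + (u 0 * G A k + G u′ k)
      ≈⟨ solve 5 (λ a v w g h → (a :* v :+ w) :+ (a :* g :+ h) := (w :+ h) :+ a :* (v :+ g)) refl (u 0) (V A 0 k) (V u′ 0 k) (G A k) (G u′ k) ⟩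
    (V u′ 0 k + G u′ k) + u 0 * (V A 0 k + G A k)
      -- If a part ends at the threshold, the next part i + 1 is counted i + 1 times on top of its
      -- weight i. Since (i + 1) A_i = i B_i, these compositions contribute exactly a cycle.
      ≈⟨ +-cong (collect u′) (*-congˡ (trans (collect A) (trans (G-cong (λ i → solve 2 (λ i a → (con 1 :+ i) :* (i :* a) := i :* ((con 1 :+ i) :* a)) refl (ι i) (e (suc i))) k) (sym (cyc≈G k))))) ⟩
    G (λ i → ι (suc i) * u′ i) k + u 0 * cyc k
      ≈⟨ +-congʳ (trans (+-congʳ (trans (*-congʳ (zeroˡ _)) (zeroˡ _))) (+-identityˡ _)) ⟨
    V u 0 (suc k) + u 0 * cyc k ∎
    where
    u′ = u ∘ suc
    collect : ∀ v → V v 0 k + G v k ≈ G (λ i → ι (suc i) * v i) k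
    collect v = trans (sym (G-+ (λ i → ι i * v i) v k))
      (G-cong (λ i → solve 2 (λ i a → i :* a :+ a := (con 1 :+ i) :* a) refl (ι i) (v i)) k)
  V-recurrence u (suc s) k = begin
    (u 0 * V A (suc s) k + V u′ (suc s) k) + (u 0 * G A (suc (s +ℕ k)) + G u′ (suc (s +ℕ k)))
      ≈⟨ solve 5 (λ a v w g h → (a :* v :+ w) :+ (a :* g :+ h) := a :* (v :+ g) :+ (w :+ h)) refl
           (u 0) (V A (suc s) k) (V u′ (suc s) k) (G A (suc (s +ℕ k))) (G u′ (suc (s +ℕ k))) ⟩
    u 0 * (V A (suc s) k + G A (suc (s +ℕ k))) + (V u′ (suc s) k + G u′ (suc (s +ℕ k)))
      ≈⟨ +-cong (*-congˡ (V-recurrence A s k)) (V-recurrence u′ s k) ⟩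
    u 0 * (V A s (suc k) + G A s * cyc k) + (V u′ s (suc k) + G u′ s * cyc k)
      ≈⟨ solve 6 (λ a v w g h c → a :* (v :+ g :* c) :+ (w :+ h :* c) := (a :* v :+ w) :+ (a :* g :+ h) :* c) refl
           (u 0) (V A s (suc k)) (V u′ s (suc k)) (G A s) (G u′ s) (cyc k) ⟩
    V u (suc s) (suc k) + G u (suc s) * cyc k ∎
    where u′ = u ∘ suc

  -- Induction on the tail length for all cycle lengths at once: the recurrence trades a tail vertex
  -- for a cycle vertex until only a cycle is left.
  tad≈V : ∀ b k → tad k b ≈ V B b k
  tad≈V zero    k = trans (tad-zero k) (cyc≈G k)
  tad≈V (suc b) k = cancel (p (suc (k +ℕ b))) _ _ (begin
    p (suc (k +ℕ b)) + tad k (suc b)        ≈⟨ +-comm _ _ ⟩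
    tad k (suc b) + p (suc (k +ℕ b))        ≈⟨ tad-recurrence k b ⟩
    tad (suc k) b + cyc k * p b             ≈⟨ +-cong (tad≈V b (suc k)) (trans (*-congˡ (p≈G b)) (*-comm _ _)) ⟩
    V B b (suc k) + G B b * cyc k           ≈⟨ V-recurrence B b k ⟨
    V B (suc b) k + G B (suc (b +ℕ k))      ≡⟨ ≡.cong (λ m → V B (suc b) k + G B (suc m)) (ℕ.+-comm b k) ⟩
    V B (suc b) k + G B (suc (k +ℕ b))      ≈⟨ +-congˡ (p≈G (suc (k +ℕ b))) ⟨
    V B (suc b) k + p (suc (k +ℕ b))        ≈⟨ +-comm _ _ ⟩
    p (suc (k +ℕ b)) + V B (suc b) k        ∎)

  -- Evaluation of weighted compositions

  elementary : List ℕ → Carrier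
  elementary []       = 1#
  elementary (k ∷ λs) = e k * elementary λs

  value : List (List ℕ × ℕ) → Carrier
  value []              = 0#
  value ((λs , w) ∷ ts) = ι w * elementary λs + value ts

  value-++ : ∀ ts us → value (ts ++ us) ≈ value ts + value us
  value-++ []       us = sym (+-identityˡ _)
  value-++ (t ∷ ts) us = trans (+-congˡ (value-++ ts us)) (sym (+-assoc _ _ _))

  value-prepend : ∀ k w ts → value (prepend k w ts) ≈ ι w * e k * value ts
  value-prepend k w []               = sym (zeroʳ _)
  value-prepend k w ((λs , w′) ∷ ts) = begin
    ι (w *ℕ w′) * (e k * elementary λs) + value (prepend k w ts)
      ≈⟨ +-cong (*-congʳ (×1-homo-* w w′)) (value-prepend k w ts) ⟩
    ι w * ι w′ * (e k * elementary λs) + ι w * e k * value ts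
      ≈⟨ solve 5 (λ w w′ a l v → w :* w′ :* (a :* l) :+ w :* a :* v := w :* a :* (w′ :* l :+ v)) refl
           (ι w) (ι w′) (e k) (elementary λs) (value ts) ⟩
    ι w * e k * (ι w′ * elementary λs + value ts) ∎

  shift-weights : ∀ {u : ℕ → Carrier} (w : ℕ → ℕ) o → (∀ i → u i ≈ ι (w i) * e (suc (o +ℕ i))) →
                  ∀ i → u (suc i) ≈ ι (w (suc i)) * e (suc (suc o +ℕ i))
  shift-weights w o p i = trans (p (suc i)) (*-congˡ (reflexive (≡.cong (e ∘ suc) (ℕ.+-suc o i))))

  first-weight : ∀ {u : ℕ → Carrier} (w : ℕ → ℕ) o → (∀ i → u i ≈ ι (w i) * e (suc (o +ℕ i))) → u 0 ≈ ι (w 0) * e (suc o)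
  first-weight w o p = trans (p 0) (*-congˡ (reflexive (≡.cong (e ∘ suc) (ℕ.+-identityʳ o))))

  -- The offset `o` records the units of the first part that have already been read, so `u i` stands
  -- for the part o + i + 1.
  G≈value : ∀ {u : ℕ → Carrier} (w : ℕ → ℕ) o k → (∀ i → u i ≈ ι (w i) * e (suc (o +ℕ i))) → G u k ≈ value (quotientTerms w o k)
  G≈value w o zero    p = trans (first-weight w o p) (sym (trans (+-identityʳ _) (*-congˡ (*-identityʳ _))))
  G≈value w o (suc k) p = sym (trans (value-++ (prepend (suc o) (w 0) (quotientTerms id 0 k)) _)
    (+-cong (trans (value-prepend (suc o) (w 0) (quotientTerms id 0 k))
              (*-cong (sym (first-weight w o p)) (sym (G≈value id 0 k (λ i → refl)))))
            (sym (G≈value (w ∘ suc) (suc o) k (shift-weights w o p)))))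

  V≈value : ∀ {u : ℕ → Carrier} (w : ℕ → ℕ) o s k → (∀ i → u i ≈ ι (w i) * e (suc (o +ℕ i))) → V u s k ≈ value (tadpoleTerms w o s k)
  V≈value w o zero    k p = G≈value (λ i → i *ℕ w i) o k
    (λ i → trans (*-congˡ (p i)) (trans (sym (*-assoc _ _ _)) (*-congʳ (sym (×1-homo-* i (w i))))))
  V≈value w o (suc s) k p = sym (trans (value-++ (prepend (suc o) (w 0) (tadpoleTerms id 0 s k)) _)
    (+-cong (trans (value-prepend (suc o) (w 0) (tadpoleTerms id 0 s k))
              (*-cong (sym (first-weight w o p)) (sym (V≈value id 0 s k (λ i → refl)))))
            (sym (V≈value (w ∘ suc) (suc o) s k (shift-weights w o p)))))

  elementary-↭ : ∀ {λs μs} → λs ↭ μs → elementary λs ≈ elementary μs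
  elementary-↭ ↭.refl         = refl
  elementary-↭ (↭.prep k p)   = *-congˡ (elementary-↭ p)
  elementary-↭ (↭.swap k l p) = trans (*-congˡ (*-congˡ (elementary-↭ p)))
    (solve 3 (λ a b c → a :* (b :* c) := b :* (a :* c)) refl (e k) (e l) _)
  elementary-↭ (↭.trans p q)  = trans (elementary-↭ p) (elementary-↭ q)

  value-sortTerms : ∀ ts → value ts ≈ value (sortTerms ts)
  value-sortTerms []              = refl
  value-sortTerms ((λs , w) ∷ ts) = +-cong (*-congˡ (elementary-↭ (↭.↭-sym (sort-↭ λs)))) (value-sortTerms ts)

-- Finite sums over lists and Boolean tests

open ≡ using (refl; cong; cong₂; subst; sym; trans)

private
  variable
    X Y : Set

∑ : List X → (X → ℕ) → ℕ
∑ xs f = sumℕ (map f xs)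

∑-cong : ∀ (xs : List X) {f g} → (∀ x → f x ≡ g x) → ∑ xs f ≡ ∑ xs g
∑-cong xs p = cong sumℕ (map-cong p xs)

∑-++ : ∀ (xs ys : List X) f → ∑ (xs ++ ys) f ≡ ∑ xs f +ℕ ∑ ys f
∑-++ xs ys f = trans (cong sumℕ (map-++ f xs ys)) (sum-++ (map f xs) (map f ys))

∑-zero : ∀ (xs : List X) → ∑ xs (λ _ → 0) ≡ 0
∑-zero []       = refl
∑-zero (x ∷ xs) = ∑-zero xs

∑-+ : ∀ (xs : List X) f g → ∑ xs (λ x → f x +ℕ g x) ≡ ∑ xs f +ℕ ∑ xs g
∑-+ []       f g = refl
∑-+ (x ∷ xs) f g = trans (cong ((f x +ℕ g x) +ℕ_) (∑-+ xs f g))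
  (solve 4 (λ a b c d → (a :+ b) :+ (c :+ d) := (a :+ c) :+ (b :+ d)) refl (f x) (g x) (∑ xs f) (∑ xs g))
  where open Algebra.Solver.Ring.NaturalCoefficients.Default ℕ.+-*-commutativeSemiring

∑-filter : ∀ b (xs : List X) f → ∑ (filterᵇ b xs) f ≡ ∑ xs (λ x → if b x then f x else 0)
∑-filter b []       f = refl
∑-filter b (x ∷ xs) f with b x
... | true  = cong (f x +ℕ_) (∑-filter b xs f)
... | false = ∑-filter b xs f

∑-comm : ∀ (xs : List X) (ys : List Y) (f : X → Y → ℕ) → ∑ xs (λ x → ∑ ys (f x)) ≡ ∑ ys (λ y → ∑ xs (λ x → f x y))
∑-comm []       ys f = sym (∑-zero ys)
∑-comm (x ∷ xs) ys f = trans (cong (∑ ys (f x) +ℕ_) (∑-comm xs ys f)) (sym (∑-+ ys (f x) (λ y → ∑ xs (λ x → f x y))))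

∑-map : ∀ (g : Y → X) ys f → ∑ (map g ys) f ≡ ∑ ys (f ∘ g)
∑-map g ys f = cong sumℕ (sym (map-∘ ys))

∑-concatMap : ∀ (g : Y → List X) ys f → ∑ (concatMap g ys) f ≡ ∑ ys (λ y → ∑ (g y) f)
∑-concatMap g []       f = refl
∑-concatMap g (y ∷ ys) f = trans (∑-++ (g y) (concatMap g ys) f) (cong (∑ (g y) f +ℕ_) (∑-concatMap g ys f))

∑-allFin : ∀ n (f : Fin (suc n) → ℕ) → ∑ (allFin (suc n)) f ≡ f zero +ℕ ∑ (allFin n) (f ∘ suc)
∑-allFin n f = cong (λ l → f zero +ℕ sumℕ l) (trans (map-tabulate suc f) (sym (map-tabulate id (f ∘ suc))))

lookup-ext : ∀ {n} {u v : Vec X n} → (∀ j → lookup u j ≡ lookup v j) → u ≡ v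
lookup-ext {u = u} {v} p = trans (sym (tabulate∘lookup u)) (trans (tabulate-cong p) (tabulate∘lookup v))

∑-lookup : ∀ {m} (s : Vec Bool m) j →
           ∑ (allFin m) (λ i → if lookup s i then (if i =ᶠ j then 1 else 0) else 0) ≡ (if lookup s j then 1 else 0)
∑-lookup {suc m} (b ∷ s) zero    = trans (∑-allFin m _)
  (trans (cong ((if b then 1 else 0) +ℕ_) (trans (∑-cong (allFin m) (λ i → if-same (lookup s i))) (∑-zero (allFin m)))) (ℕ.+-identityʳ _))
  where
  if-same : ∀ b → (if b then 0 else 0) ≡ 0
  if-same true  = refl
  if-same false = refl
∑-lookup {suc m} (b ∷ s) (suc j) = trans (∑-allFin m _) (head-zero b)
  where
  head-zero : ∀ b → (if b then 0 else 0) +ℕ ∑ (allFin m) (λ i → if lookup s i then (if i =ᶠ j then 1 else 0) else 0)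
                      ≡ (if lookup s j then 1 else 0)
  head-zero true  = ∑-lookup s j
  head-zero false = ∑-lookup s j

if-∧ : ∀ {A : Set} b b′ {u v : A} → (if b ∧ b′ then u else v) ≡ (if b then (if b′ then u else v) else v)
if-∧ true  b′ = refl
if-∧ false b′ = refl

T-ext : ∀ {p q} → (T p → T q) → (T q → T p) → p ≡ q
T-ext {true}  {true}  _ _ = refl
T-ext {true}  {false} f _ = ⊥-elim (f _)
T-ext {false} {true}  _ g = ⊥-elim (g _)
T-ext {false} {false} _ _ = refl

T-⇒ : ∀ {p q} → T p → T (not p ∨ q) → T q
T-⇒ {true} _ t = t

⇒-T : ∀ p {q} → (T p → T q) → T (not p ∨ q)
⇒-T true  f = f _
⇒-T false f = _

T-∨-skip : ∀ p {q} → T q → T (p ∨ q)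
T-∨-skip true  _ = _
T-∨-skip false t = t

all-allFin⁻ : ∀ {m} {p : Fin m → Bool} → T (all p (allFin m)) → ∀ i → T (p i)
all-allFin⁻ {m} {p} t = tabulate⁻ (all⁺ p (allFin m) t)

all-allFin⁺ : ∀ {m} {p : Fin m → Bool} → (∀ i → T (p i)) → T (all p (allFin m))
all-allFin⁺ {p = p} f = all⁻ p (tabulate⁺ f)

-- Polynomials in n variables with coefficients in ℕ, as lists of exponent
-- vectors up to permutation; sums of test functions over the lists separate them.
module Polynomials (n : ℕ) where

  Monomial : Set
  Monomial = Vec ℕ n

  infixl 7 _∙_
  _∙_ : Monomial → Monomial → Monomial
  _∙_ = zipWith _+ℕ_

  ε : Monomial
  ε = replicate n 0

  Polynomial : Set
  Polynomial = List Monomial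

  infix 4 _≐_
  -- With all `φ` allowed as tests, φ (m ∙ _) is again a test, so `⊗` respects the relation
  -- directly. Additive cancellation comes from ℕ, and the test `hasExponents α` extracts a
  -- coefficient.
  record _≐_ (p q : Polynomial) : Set where
    constructor equalSums
    field sums : ∀ φ → ∑ p φ ≡ ∑ q φ

  open _≐_ public

  infixl 7 _⊗_
  _⊗_ : Polynomial → Polynomial → Polynomial
  p ⊗ q = concatMap (λ m → map (m ∙_) q) p

  ∑-⊗ : ∀ p q φ → ∑ (p ⊗ q) φ ≡ ∑ p (λ m → ∑ q (λ m′ → φ (m ∙ m′)))
  ∑-⊗ p q φ = trans (∑-concatMap (λ m → map (m ∙_) q) p φ) (∑-cong p (λ m → ∑-map (m ∙_) q φ))

  polynomials : CommutativeSemiring 0ℓ 0ℓ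
  polynomials = record
    { Carrier = Polynomial
    ; _≈_     = _≐_
    ; _+_     = _++_
    ; _*_     = _⊗_
    ; 0#      = []
    ; 1#      = [ ε ]
    ; isCommutativeSemiring = isCommutativeSemiringˡ record
      { +-isCommutativeMonoid = record
        { isMonoid = record
          { isSemigroup = record
            { isMagma = record
              { isEquivalence = ≐-isEquivalence
              ; ∙-cong = λ {p} {p′} {q} {q′} e f → equalSums λ φ →
                  trans (∑-++ p q φ) (trans (cong₂ _+ℕ_ (sums e φ) (sums f φ)) (sym (∑-++ p′ q′ φ)))
              }
            ; assoc = λ p q r → equalSums λ φ → cong (λ s → ∑ s φ) (++-assoc p q r)
            }
          ; identity = (λ p → equalSums λ φ → refl) , (λ p → equalSums λ φ → cong (λ s → ∑ s φ) (++-identityʳ p))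
          }
        ; comm = λ p q → equalSums λ φ → trans (∑-++ p q φ) (trans (ℕ.+-comm (∑ p φ) (∑ q φ)) (sym (∑-++ q p φ)))
        }
      ; *-isCommutativeMonoid = record
        { isMonoid = record
          { isSemigroup = record
            { isMagma = record
              { isEquivalence = ≐-isEquivalence
              ; ∙-cong = ⊗-cong
              }
            ; assoc = ⊗-assoc
            }
          ; identity = ⊗-identityˡ , (λ p → ≐-trans (⊗-comm p [ ε ]) (⊗-identityˡ p))
          }
        ; comm = ⊗-comm
        }
      ; distribʳ = λ r p q → equalSums λ φ → trans (∑-⊗ (p ++ q) r φ)
          (trans (∑-++ p q _) (trans (sym (cong₂ _+ℕ_ (∑-⊗ p r φ) (∑-⊗ q r φ))) (sym (∑-++ (p ⊗ r) (q ⊗ r) φ))))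
      ; zeroˡ    = λ p → equalSums λ φ → refl
      }
    }
    where
    ≐-trans : ∀ {p q r} → p ≐ q → q ≐ r → p ≐ r
    ≐-trans e f = equalSums λ φ → trans (sums e φ) (sums f φ)

    ≐-isEquivalence : IsEquivalence _≐_
    ≐-isEquivalence = record
      { refl  = equalSums λ φ → refl
      ; sym   = λ e → equalSums λ φ → sym (sums e φ)
      ; trans = ≐-trans
      }

    ⊗-cong : ∀ {p p′ q q′} → p ≐ p′ → q ≐ q′ → p ⊗ q ≐ p′ ⊗ q′
    ⊗-cong {p} {p′} {q} {q′} e f = equalSums λ φ → begin
      ∑ (p ⊗ q) φ                             ≡⟨ ∑-⊗ p q φ ⟩
      ∑ p (λ m → ∑ q (λ m′ → φ (m ∙ m′)))     ≡⟨ sums e _ ⟩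
      ∑ p′ (λ m → ∑ q (λ m′ → φ (m ∙ m′)))    ≡⟨ ∑-cong p′ (λ m → sums f _) ⟩
      ∑ p′ (λ m → ∑ q′ (λ m′ → φ (m ∙ m′)))   ≡⟨ ∑-⊗ p′ q′ φ ⟨
      ∑ (p′ ⊗ q′) φ                           ∎
      where open ≡-Reasoning

    ⊗-comm : ∀ p q → p ⊗ q ≐ q ⊗ p
    ⊗-comm p q = equalSums λ φ → begin
      ∑ (p ⊗ q) φ                          ≡⟨ ∑-⊗ p q φ ⟩
      ∑ p (λ m → ∑ q (λ m′ → φ (m ∙ m′)))  ≡⟨ ∑-comm p q (λ m m′ → φ (m ∙ m′)) ⟩
      ∑ q (λ m′ → ∑ p (λ m → φ (m ∙ m′)))  ≡⟨ ∑-cong q (λ m′ → ∑-cong p (λ m → cong φ (zipWith-comm ℕ.+-comm m m′))) ⟩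
      ∑ q (λ m′ → ∑ p (λ m → φ (m′ ∙ m)))  ≡⟨ ∑-⊗ q p φ ⟨
      ∑ (q ⊗ p) φ                          ∎
      where open ≡-Reasoning

    ⊗-assoc : ∀ p q r → (p ⊗ q) ⊗ r ≐ p ⊗ (q ⊗ r)
    ⊗-assoc p q r = equalSums λ φ → begin
      ∑ ((p ⊗ q) ⊗ r) φ
        ≡⟨ ∑-⊗ (p ⊗ q) r φ ⟩
      ∑ (p ⊗ q) (λ m → ∑ r (λ k → φ (m ∙ k)))
        ≡⟨ ∑-⊗ p q _ ⟩
      ∑ p (λ m → ∑ q (λ l → ∑ r (λ k → φ ((m ∙ l) ∙ k))))
        ≡⟨ ∑-cong p (λ m → ∑-cong q (λ l → ∑-cong r (λ k → cong φ (zipWith-assoc ℕ.+-assoc m l k)))) ⟩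
      ∑ p (λ m → ∑ q (λ l → ∑ r (λ k → φ (m ∙ (l ∙ k)))))
        ≡⟨ ∑-cong p (λ m → ∑-⊗ q r (λ k → φ (m ∙ k))) ⟨
      ∑ p (λ m → ∑ (q ⊗ r) (λ k → φ (m ∙ k)))
        ≡⟨ ∑-⊗ p (q ⊗ r) φ ⟨
      ∑ (p ⊗ (q ⊗ r)) φ ∎
      where open ≡-Reasoning

    ⊗-identityˡ : ∀ p → [ ε ] ⊗ p ≐ p
    ⊗-identityˡ p = equalSums λ φ → trans (∑-⊗ [ ε ] p φ)
      (trans (ℕ.+-identityʳ _) (∑-cong p (λ m → cong φ (zipWith-identityˡ ℕ.+-identityˡ m))))

  ++-cancelˡ : Algebra.Definitions.LeftCancellative _≐_ _++_
  ++-cancelˡ p q r e = equalSums λ φ → ℕ.+-cancelˡ-≡ (∑ p φ) _ _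
    (trans (sym (∑-++ p q φ)) (trans (sums e φ) (∑-++ p r φ)))

  unit : Fin n → Monomial
  unit i = tabulate (λ j → if i =ᶠ j then 1 else 0)

  var : Fin n → Polynomial
  var i = [ unit i ]

  ∑-var : ∀ i p φ → ∑ (var i ⊗ p) φ ≡ ∑ p (λ m → φ (unit i ∙ m))
  ∑-var i p φ = trans (∑-⊗ (var i) p φ) (ℕ.+-identityʳ _)

  open PowerSeries polynomials
  open Elementary polynomials
  open Kronecker polynomials
  open Words polynomials ++-cancelˡ var
  private
    module P = CommutativeSemiring polynomials
    module PΣ = Algebra.Properties.Semiring.Sum P.semiring

  ∑-sum : ∀ {m} (f : Fin m → Polynomial) φ → ∑ (PΣ.sum f) φ ≡ ∑ (allFin m) (λ i → ∑ (f i) φ)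
  ∑-sum {zero}  f φ = refl
  ∑-sum {suc m} f φ = trans (∑-++ (f zero) (PΣ.sum (f ∘ suc)) φ)
    (trans (cong (∑ (f zero) φ +ℕ_) (∑-sum (f ∘ suc) φ)) (sym (∑-allFin m (λ i → ∑ (f i) φ))))

  ∑-ι : ∀ k p φ → ∑ (ι k ⊗ p) φ ≡ k *ℕ ∑ p φ
  ∑-ι zero    p φ = refl
  ∑-ι (suc k) p φ = begin
    ∑ (([ ε ] ++ ι k) ⊗ p) φ           ≡⟨ sums (P.distribʳ p [ ε ] (ι k)) φ ⟩
    ∑ ([ ε ] ⊗ p ++ ι k ⊗ p) φ         ≡⟨ ∑-++ ([ ε ] ⊗ p) (ι k ⊗ p) φ ⟩
    ∑ ([ ε ] ⊗ p) φ +ℕ ∑ (ι k ⊗ p) φ   ≡⟨ cong₂ _+ℕ_ (sums (P.*-identityˡ p) φ) (∑-ι k p φ) ⟩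
    ∑ p φ +ℕ k *ℕ ∑ p φ                 ∎
    where open ≡-Reasoning

  -- Elementary symmetric functions

  -- `E` drops its variables one by one while the monomials keep all `n` exponents; `f` tells which
  -- variables are left.
  subsetMonomial : ∀ {m} → (Fin m → Fin n) → Subset m → Monomial
  subsetMonomial f []          = ε
  subsetMonomial f (true ∷ s)  = unit (f zero) ∙ subsetMonomial (f ∘ suc) s
  subsetMonomial f (false ∷ s) = subsetMonomial (f ∘ suc) s

  ∑-subsets : ∀ m (g : Subset (suc m) → ℕ) →
              ∑ (allVecs (true ∷ false ∷ []) (suc m)) g
                ≡ ∑ (allVecs (true ∷ false ∷ []) m) (g ∘ (true ∷_)) +ℕ ∑ (allVecs (true ∷ false ∷ []) m) (g ∘ (false ∷_))
  ∑-subsets m g = trans (∑-concatMap (λ b → map (b ∷_) Vs) (true ∷ false ∷ []) g)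
    (cong₂ _+ℕ_ (∑-map (true ∷_) Vs g) (trans (ℕ.+-identityʳ _) (∑-map (false ∷_) Vs g)))
    where Vs = allVecs (true ∷ false ∷ []) m

  ∑-E : ∀ {m} (f : Fin m → Fin n) k φ →
        ∑ (E (var ∘ f) k) φ ≡ ∑ (allVecs (true ∷ false ∷ []) m) (λ s → if size s == k then φ (subsetMonomial f s) else 0)
  ∑-E {zero}  f zero    φ = refl
  ∑-E {zero}  f (suc k) φ = refl
  ∑-E {suc m} f zero    φ = begin
    ∑ (E (var ∘ f) 0) φ
      ≡⟨ sums (P.trans (1+linear (var (f zero)) E′ 0) (P.+-congʳ (⊛-linearˡ-zero (var (f zero)) E′))) φ ⟩
    ∑ (E′ 0) φ
      ≡⟨ ∑-E (f ∘ suc) 0 φ ⟩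
    ∑ Vs (λ s → if size s == 0 then φ (subsetMonomial (f ∘ suc) s) else 0)
      -- Subsets that contain the first element are nonempty, so their half of the sum is 0.
      ≡⟨ cong (_+ℕ ∑ Vs (λ s → if size s == 0 then φ (subsetMonomial (f ∘ suc) s) else 0)) (∑-zero Vs) ⟨
    ∑ Vs (λ _ → 0) +ℕ ∑ Vs (λ s → if size s == 0 then φ (subsetMonomial (f ∘ suc) s) else 0)
      ≡⟨ ∑-subsets m _ ⟨
    ∑ (allVecs (true ∷ false ∷ []) (suc m)) (λ s → if size s == 0 then φ (subsetMonomial f s) else 0) ∎
    where
    open ≡-Reasoning
    E′ = E (var ∘ f ∘ suc)
    Vs = allVecs (true ∷ false ∷ []) m
  ∑-E {suc m} f (suc k) φ = begin
    ∑ (E (var ∘ f) (suc k)) φ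
      ≡⟨ sums (P.trans (1+linear (var (f zero)) E′ (suc k)) (P.+-congʳ (⊛-linearˡ-suc (var (f zero)) E′ k))) φ ⟩
    ∑ (var (f zero) ⊗ E′ k ++ E′ (suc k)) φ
      ≡⟨ ∑-++ (var (f zero) ⊗ E′ k) (E′ (suc k)) φ ⟩
    ∑ (var (f zero) ⊗ E′ k) φ +ℕ ∑ (E′ (suc k)) φ
      ≡⟨ cong₂ _+ℕ_ (trans (∑-var (f zero) (E′ k) φ) (∑-E (f ∘ suc) k _)) (∑-E (f ∘ suc) (suc k) φ) ⟩
    ∑ Vs (λ s → if size s == k then φ (unit (f zero) ∙ subsetMonomial (f ∘ suc) s) else 0)
      +ℕ ∑ Vs (λ s → if size s == suc k then φ (subsetMonomial (f ∘ suc) s) else 0)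
      ≡⟨ ∑-subsets m _ ⟨
    ∑ (allVecs (true ∷ false ∷ []) (suc m)) (λ s → if size s == suc k then φ (subsetMonomial f s) else 0) ∎
    where
    open ≡-Reasoning
    E′ = E (var ∘ f ∘ suc)
    Vs = allVecs (true ∷ false ∷ []) m

  indicator : Subset n → Monomial
  indicator s = tabulate (λ j → if lookup s j then 1 else 0)

  lookup-subsetMonomial : ∀ {m} (f : Fin m → Fin n) s j →
    lookup (subsetMonomial f s) j ≡ ∑ (allFin m) (λ i → if lookup s i then (if f i =ᶠ j then 1 else 0) else 0)
  lookup-subsetMonomial f [] j = lookup-replicate j 0
  lookup-subsetMonomial {suc m} f (true ∷ s) j = trans (lookup-zipWith _+ℕ_ j (unit (f zero)) (subsetMonomial (f ∘ suc) s))
    (trans (cong₂ _+ℕ_ (lookup∘tabulate _ j) (lookup-subsetMonomial (f ∘ suc) s j)) (sym (∑-allFin m _)))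
  lookup-subsetMonomial {suc m} f (false ∷ s) j = trans (lookup-subsetMonomial (f ∘ suc) s j)
    (sym (∑-allFin m (λ i → if lookup (false ∷ s) i then (if f i =ᶠ j then 1 else 0) else 0)))

  subsetMonomial-id : ∀ s → subsetMonomial id s ≡ indicator s
  subsetMonomial-id s = lookup-ext λ j →
    trans (lookup-subsetMonomial id s j) (trans (∑-lookup s j) (sym (lookup∘tabulate _ j)))

  ∑-e : ∀ k φ → ∑ (e k) φ ≡ ∑ (subsetsOfSize n k) (φ ∘ indicator)
  ∑-e k φ = begin
    ∑ (e k) φ
      ≡⟨ ∑-E id k φ ⟩
    ∑ Vs (λ s → if size s == k then φ (subsetMonomial id s) else 0)
      ≡⟨ ∑-cong Vs (λ s → cong (λ m → if size s == k then φ m else 0) (subsetMonomial-id s)) ⟩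
    ∑ Vs (λ s → if size s == k then φ (indicator s) else 0)
      ≡⟨ ∑-filter (λ s → size s == k) Vs (φ ∘ indicator) ⟨
    ∑ (subsetsOfSize n k) (φ ∘ indicator) ∎
    where
    open ≡-Reasoning
    Vs = allVecs (true ∷ false ∷ []) n

  tupleMonomial : List (Subset n) → Monomial
  tupleMonomial Ss = tabulate (multiplicity Ss)

  ∑-elementary : ∀ λs φ → ∑ (elementary λs) φ ≡ ∑ (tuplesOfSubsets n λs) (φ ∘ tupleMonomial)
  ∑-elementary [] φ = cong (λ m → φ m +ℕ 0) (lookup-ext λ j → trans (lookup-replicate j 0) (sym (lookup∘tabulate _ j)))
  ∑-elementary (k ∷ λs) φ = begin
    ∑ (e k ⊗ elementary λs) φ
      ≡⟨ ∑-⊗ (e k) (elementary λs) φ ⟩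
    ∑ (e k) (λ m → ∑ (elementary λs) (λ m′ → φ (m ∙ m′)))
      ≡⟨ ∑-e k _ ⟩
    ∑ (subsetsOfSize n k) (λ S → ∑ (elementary λs) (λ m′ → φ (indicator S ∙ m′)))
      ≡⟨ ∑-cong (subsetsOfSize n k) (λ S → ∑-elementary λs _) ⟩
    ∑ (subsetsOfSize n k) (λ S → ∑ (tuplesOfSubsets n λs) (λ Ss → φ (indicator S ∙ tupleMonomial Ss)))
      ≡⟨ ∑-cong (subsetsOfSize n k) (λ S → ∑-cong (tuplesOfSubsets n λs) (λ Ss → cong φ (tupleMonomial-∷ S Ss))) ⟨
    ∑ (subsetsOfSize n k) (λ S → ∑ (tuplesOfSubsets n λs) (λ Ss → φ (tupleMonomial (S ∷ Ss))))
      ≡⟨ ∑-cong (subsetsOfSize n k) (λ S → ∑-map (S ∷_) (tuplesOfSubsets n λs) (φ ∘ tupleMonomial)) ⟨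
    ∑ (subsetsOfSize n k) (λ S → ∑ (map (S ∷_) (tuplesOfSubsets n λs)) (φ ∘ tupleMonomial))
      ≡⟨ ∑-concatMap (λ S → map (S ∷_) (tuplesOfSubsets n λs)) (subsetsOfSize n k) (φ ∘ tupleMonomial) ⟨
    ∑ (tuplesOfSubsets n (k ∷ λs)) (φ ∘ tupleMonomial) ∎
    where
    open ≡-Reasoning
    tupleMonomial-∷ : ∀ S Ss → tupleMonomial (S ∷ Ss) ≡ indicator S ∙ tupleMonomial Ss
    tupleMonomial-∷ S Ss = lookup-ext λ j → trans (lookup∘tabulate _ j)
      (sym (trans (lookup-zipWith _+ℕ_ j (indicator S) (tupleMonomial Ss)) (cong₂ _+ℕ_ (lookup∘tabulate _ j) (lookup∘tabulate _ j))))

  hasExponents : (Fin n → ℕ) → Monomial → ℕ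
  hasExponents α m = if all (λ j → lookup m j == α j) (allFin n) then 1 else 0

  hasExponents-tabulate : ∀ α f → hasExponents α (tabulate f) ≡ (if all (λ j → f j == α j) (allFin n) then 1 else 0)
  hasExponents-tabulate α f = cong (λ bs → if and bs then 1 else 0)
    (map-cong (λ j → cong (_== α j) (lookup∘tabulate f j)) (allFin n))

  ∑-coeffE : ∀ λs α → ∑ (elementary λs) (hasExponents α) ≡ coeffE λs n α
  ∑-coeffE λs α = trans (∑-elementary λs (hasExponents α))
    (∑-cong (tuplesOfSubsets n λs) (λ Ss → hasExponents-tabulate α (multiplicity Ss)))

  -- Colourings

  content : ∀ {d} → Vec (Fin n) d → Monomial
  content {d} κ = tabulate (λ j → countB (λ i → lookup κ i =ᶠ j) (allFin d))

  content-[] : ε ≡ content []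
  content-[] = lookup-ext λ j → trans (lookup-replicate j 0) (sym (lookup∘tabulate _ j))

  content-∷ : ∀ {d} c (κ : Vec (Fin n) d) → content (c ∷ κ) ≡ unit c ∙ content κ
  content-∷ {d} c κ = lookup-ext λ j → trans (lookup∘tabulate _ j) (trans (∑-allFin d _)
    (sym (trans (lookup-zipWith _+ℕ_ j (unit c) (content κ)) (cong₂ _+ℕ_ (lookup∘tabulate _ j) (lookup∘tabulate _ j)))))

  ∑-coeffX : ∀ {d} (G : SimpleGraph d) α →
    coeffX G n α ≡ ∑ (allVecs (allFin n) d) (λ κ → if isProper G κ then hasExponents α (content κ) else 0)
  ∑-coeffX {d} G α = ∑-cong (allVecs (allFin n) d) λ κ → trans (if-∧ (isProper G κ) (hasContent κ α))
    (cong (λ v → if isProper G κ then v else 0) (sym (hasExponents-tabulate α _)))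

  ∑-colourings : ∀ d (g : Vec (Fin n) (suc d) → ℕ) →
    ∑ (allVecs (allFin n) (suc d)) g ≡ ∑ (allFin n) (λ c → ∑ (allVecs (allFin n) d) (λ κ → g (c ∷ κ)))
  ∑-colourings d g = trans (∑-concatMap (λ c → map (c ∷_) (allVecs (allFin n) d)) (allFin n) g)
    (∑-cong (allFin n) (λ c → ∑-map (c ∷_) (allVecs (allFin n) d) g))

  chain : ∀ {d} → Fin n → Vec (Fin n) d → Bool
  chain c []      = true
  chain c (d ∷ κ) = not (c =ᶠ d) ∧ chain d κ

  at : ∀ k {b} → Fin n → Vec (Fin n) (k +ℕ b) → Fin n
  at zero    c κ       = c
  at (suc k) c (d ∷ κ) = at k d κ

  ∑-step : ∀ d c (p : Fin n → Polynomial) (q : Fin n → Vec (Fin n) d → Bool) φ →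
    (∀ c′ → ∑ (p c′) φ ≡ ∑ (allVecs (allFin n) d) (λ κ → if q c′ κ then φ (content (c′ ∷ κ)) else 0)) →
    ∑ (PΣ.sum (λ c′ → ν c c′ ⊗ p c′)) φ
      ≡ ∑ (allVecs (allFin n) (suc d)) (λ { (c′ ∷ κ) → if not (c =ᶠ c′) ∧ q c′ κ then φ (content (c′ ∷ κ)) else 0 })
  ∑-step d c p q φ hyp = trans (∑-sum (λ c′ → ν c c′ ⊗ p c′) φ)
    (trans (∑-cong (allFin n) term) (sym (∑-colourings d _)))
    where
    term : ∀ c′ → ∑ (ν c c′ ⊗ p c′) φ
                    ≡ ∑ (allVecs (allFin n) d) (λ κ → if not (c =ᶠ c′) ∧ q c′ κ then φ (content (c′ ∷ κ)) else 0)
    term c′ with c =ᶠ c′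
    ... | true  = sym (∑-zero (allVecs (allFin n) d))
    ... | false = trans (sums (P.*-identityˡ (p c′)) φ) (hyp c′)

  ∑-L : ∀ b c φ → ∑ (L b c) φ ≡ ∑ (allVecs (allFin n) b) (λ κ → if chain c κ then φ (content κ) else 0)
  ∑-x*L : ∀ b c φ → ∑ (var c ⊗ L b c) φ ≡ ∑ (allVecs (allFin n) b) (λ κ → if chain c κ then φ (content (c ∷ κ)) else 0)

  ∑-L zero    c φ = cong (λ m → φ m +ℕ 0) content-[]
  ∑-L (suc b) c φ = trans (∑-step b c (λ c′ → var c′ ⊗ L b c′) chain φ (λ c′ → ∑-x*L b c′ φ))
    (∑-cong (allVecs (allFin n) (suc b)) λ { (c′ ∷ κ) → refl })

  ∑-x*L b c φ = trans (∑-var c (L b c) φ) (trans (∑-L b c _)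
    (∑-cong (allVecs (allFin n) b) (λ κ → cong (λ m → if chain c κ then φ m else 0) (sym (content-∷ c κ)))))

  -- The condition on the last cycle vertex is an arbitrary predicate `q`, because the induction
  -- moves `c` along the word while the colour to be avoided at the end stays that of the very first
  -- vertex.
  ∑-Z : ∀ k b c (q : Fin n → Bool) φ →
    ∑ (Z k c (λ d → (if q d then [] else [ ε ]) ⊗ L b d)) φ
      ≡ ∑ (allVecs (allFin n) (k +ℕ b)) (λ κ → if chain c κ ∧ not (q (at k c κ)) then φ (content (c ∷ κ)) else 0)
  ∑-Z zero b c q φ with q c
  ... | true  = sym (trans (∑-cong Vs (λ κ → cong (λ t → if t then φ (content (c ∷ κ)) else 0) (∧-zeroʳ (chain c κ)))) (∑-zero Vs))
    where Vs = allVecs (allFin n) b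
  ... | false = trans (sums (P.*-congˡ {var c} (P.*-identityˡ (L b c))) φ) (trans (∑-x*L b c φ)
    (∑-cong (allVecs (allFin n) b) (λ κ → cong (λ t → if t then φ (content (c ∷ κ)) else 0) (sym (∧-identityʳ (chain c κ))))))
  ∑-Z (suc k) b c q φ = begin
    ∑ (var c ⊗ PΣ.sum (λ c′ → ν c c′ ⊗ Z k c′ h)) φ
      ≡⟨ ∑-var c (PΣ.sum (λ c′ → ν c c′ ⊗ Z k c′ h)) φ ⟩
    ∑ (PΣ.sum (λ c′ → ν c c′ ⊗ Z k c′ h)) φ′
      ≡⟨ ∑-step (k +ℕ b) c (λ c′ → Z k c′ h) (λ c′ κ → chain c′ κ ∧ not (q (at k c′ κ))) φ′ (λ c′ → ∑-Z k b c′ q φ′) ⟩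
    ∑ (allVecs (allFin n) (suc k +ℕ b)) _
      ≡⟨ ∑-cong (allVecs (allFin n) (suc k +ℕ b)) (λ { (c′ ∷ κ) → cong₂ (λ t m → if t then φ m else 0)
           (sym (∧-assoc (not (c =ᶠ c′)) (chain c′ κ) (not (q (at k c′ κ))))) (sym (content-∷ c (c′ ∷ κ))) }) ⟩
    ∑ (allVecs (allFin n) (suc k +ℕ b)) (λ κ → if chain c κ ∧ not (q (at (suc k) c κ)) then φ (content (c ∷ κ)) else 0) ∎
    where
    open ≡-Reasoning
    h : Fin n → Polynomial
    h d = (if q d then [] else [ ε ]) ⊗ L b d
    φ′ : Monomial → ℕ
    φ′ m = φ (unit c ∙ m)

  properOnTadpole : ∀ k {b} → Vec (Fin n) (suc k +ℕ b) → Bool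
  properOnTadpole k (c ∷ κ) = chain c κ ∧ not (c =ᶠ at k c κ)

  ∑-tad : ∀ k b φ → ∑ (tad k b) φ
    ≡ ∑ (allVecs (allFin n) (suc k +ℕ b)) (λ κ → if properOnTadpole k κ then φ (content κ) else 0)
  ∑-tad k b φ = trans (∑-sum (λ i → Z k i (λ j → ν i j ⊗ L b j)) φ)
    (trans (∑-cong (allFin n) (λ c → ∑-Z k b c (c =ᶠ_) φ)) (sym (∑-colourings (k +ℕ b) _)))

  -- Proper colourings of the tadpole

  chain⇒distinct : ∀ {d} c (κ : Vec (Fin n) d) → T (chain c κ) → ∀ i j → toℕ j ≡ suc (toℕ i) →
                   T (not (lookup (c ∷ κ) i =ᶠ lookup (c ∷ κ) j))
  chain⇒distinct c (c′ ∷ κ) t zero    (suc zero) _  = proj₁ (Equivalence.to T-∧ t)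
  chain⇒distinct c (c′ ∷ κ) t (suc i) (suc j)    eq =
    chain⇒distinct c′ κ (proj₂ (Equivalence.to (T-∧ {not (c =ᶠ c′)}) t)) i j (ℕ.suc-injective eq)
  chain⇒distinct c []       t zero    zero       ()

  distinct⇒chain : ∀ {d} c (κ : Vec (Fin n) d) →
                   (∀ i j → toℕ j ≡ suc (toℕ i) → T (not (lookup (c ∷ κ) i =ᶠ lookup (c ∷ κ) j))) → T (chain c κ)
  distinct⇒chain c []       p = _
  distinct⇒chain c (c′ ∷ κ) p = Equivalence.from T-∧
    (p zero (suc zero) refl , distinct⇒chain c′ κ (λ i j eq → p (suc i) (suc j) (cong suc eq)))

  lookup-at : ∀ k {b} c (κ : Vec (Fin n) (k +ℕ b)) i → toℕ i ≡ k → lookup (c ∷ κ) i ≡ at k c κ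
  lookup-at zero    c κ        zero    _  = refl
  lookup-at (suc k) c (c′ ∷ κ) (suc i) eq = lookup-at k c′ κ i (ℕ.suc-injective eq)

  -- The edges are the consecutive pairs, which `chain` checks, and the closing pair of the vertices
  -- 0 and k. The graph lists each in both directions, hence the appeals to symmetry.
  isProper-tadpole : ∀ k b (ha : 3 ≤ suc k) κ → isProper (tadpole (suc k) b ha) κ ≡ properOnTadpole k κ
  isProper-tadpole k b ha (c ∷ κ) = T-ext to from
    where
    colour : Fin (suc k +ℕ b) → Fin n
    colour = lookup (c ∷ κ)

    end : Fin (suc k +ℕ b)
    end = fromℕ k ↑ˡ b

    toℕ-end : toℕ end ≡ k
    toℕ-end = trans (toℕ-↑ˡ (fromℕ k) b) (toℕ-fromℕ k)

    to : T (isProper (tadpole (suc k) b ha) (c ∷ κ)) → T (properOnTadpole k (c ∷ κ))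
    to t = Equivalence.from T-∧
      ( distinct⇒chain c κ (λ i j eq → distinct i j (Equivalence.from T-∨ (inj₁ (ℕ.≡⇒≡ᵇ _ _ eq))))
      , subst (λ c′ → T (not (c =ᶠ c′))) (lookup-at k c κ end toℕ-end)
          -- Of the four alternatives for adjacency with i = 0, the second computes to `false`; the
          -- first is skipped and the third is the closing edge.
          (distinct zero end (T-∨-skip (toℕ end == 1)
            (Equivalence.from T-∨ (inj₁ (ℕ.≡⇒≡ᵇ _ _ toℕ-end))))) )
      where
      distinct : ∀ i j → T (tadpoleAdj (suc k) b i j) → T (not (colour i =ᶠ colour j))
      distinct i j adj = T-⇒ adj (all-allFin⁻ (all-allFin⁻ t i) j)

    from : T (properOnTadpole k (c ∷ κ)) → T (isProper (tadpole (suc k) b ha) (c ∷ κ))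
    from t = all-allFin⁺ (λ i → all-allFin⁺ (λ j → ⇒-T (tadpoleAdj (suc k) b i j) (distinct i j)))
      where
      path : T (chain c κ)
      path = proj₁ (Equivalence.to T-∧ t)

      closing : ∀ i j → toℕ i ≡ 0 → toℕ j ≡ k → T (not (colour i =ᶠ colour j))
      closing zero j _ eq = subst (λ c′ → T (not (c =ᶠ c′))) (sym (lookup-at k c κ j eq))
        (proj₂ (Equivalence.to (T-∧ {chain c κ}) t))

      flip : ∀ i j → T (not (colour i =ᶠ colour j)) → T (not (colour j =ᶠ colour i))
      flip i j = subst (T ∘ not) (=ᶠ-sym (colour i) (colour j))

      both : ∀ {m m′ l l′} → T ((m == l) ∧ (m′ == l′)) → m ≡ l × m′ ≡ l′
      both {m} {m′} u = let (p , q) = Equivalence.to T-∧ u in ℕ.≡ᵇ⇒≡ m _ p , ℕ.≡ᵇ⇒≡ m′ _ q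

      distinct : ∀ i j → T (tadpoleAdj (suc k) b i j) → T (not (colour i =ᶠ colour j))
      distinct i j adj with Equivalence.to (T-∨ {toℕ j == suc (toℕ i)}) adj
      ... | inj₁ e = chain⇒distinct c κ path i j (ℕ.≡ᵇ⇒≡ _ _ e)
      ... | inj₂ adj′ with Equivalence.to (T-∨ {toℕ i == suc (toℕ j)}) adj′
      ...   | inj₁ e = flip j i (chain⇒distinct c κ path j i (ℕ.≡ᵇ⇒≡ _ _ e))
      ...   | inj₂ adj″ with Equivalence.to (T-∨ {(toℕ i == 0) ∧ (toℕ j == k)}) adj″
      ...     | inj₁ e = let (p , q) = both {toℕ i} {toℕ j} e in closing i j p q
      ...     | inj₂ e = let (p , q) = both {toℕ j} {toℕ i} e in flip j i (closing j i p q)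

  coeffX-tadpole : ∀ k b (ha : 3 ≤ suc k) α → coeffX (tadpole (suc k) b ha) n α ≡ ∑ (tad k b) (hasExponents α)
  coeffX-tadpole k b ha α = trans (∑-coeffX (tadpole (suc k) b ha) α)
    (trans (∑-cong (allVecs (allFin n) (suc k +ℕ b)) (λ κ → cong (λ t → if t then hasExponents α (content κ) else 0) (isProper-tadpole k b ha κ)))
      (sym (∑-tad k b (hasExponents α))))

  ∑-value : ∀ ts α → ∑ (value ts) (hasExponents α) ≡ sumℕ (map (λ t → proj₂ t *ℕ coeffE (proj₁ t) n α) ts)
  ∑-value []             α = refl
  ∑-value ((λs , w) ∷ ts) α = trans (∑-++ (ι w ⊗ elementary λs) (value ts) _)
    (cong₂ _+ℕ_ (trans (∑-ι w (elementary λs) _) (cong (w *ℕ_) (∑-coeffE λs α))) (∑-value ts α))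

theorem3p1 : (a b : ℕ) → (ha : 3 ≤ a) → 1 ≤ b → EPositive (tadpole a b ha)
theorem3p1 (suc k) b ha _ = sortTerms ts , partitions , expansion
  where
  ts : List (List ℕ × ℕ)
  -- The weight function `suc` is that of `B`, and no unit has been read yet. The list does not
  -- depend on the number of variables.
  ts = tadpoleTerms suc 0 b k

  partitions : All (λ t → IsPartition (suc k +ℕ b) (proj₁ t)) (sortTerms ts)
  partitions = sortTerms-partitions (subst (λ d → All (λ t → IsComposition d (proj₁ t)) ts)
    (cong suc (ℕ.+-comm b k)) (tadpoleTerms-compositions suc 0 b k))

  expansion : ∀ n (α : Fin n → ℕ) → coeffX (tadpole (suc k) b ha) n α
                ≡ sumℕ (map (λ t → proj₂ t *ℕ coeffE (proj₁ t) n α) (sortTerms ts))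
  expansion n α = trans (coeffX-tadpole k b ha α)
    (trans (sums (P.trans (tad≈V b k) (P.trans (V≈value suc 0 b k (λ i → P.refl)) (value-sortTerms ts))) _)
      (∑-value (sortTerms ts) α))
    where
    open Polynomials n
    open Words polynomials ++-cancelˡ var
    module P = CommutativeSemiring polynomials
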